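{- Let $p$ be a prime and let $(R, R^{+})$ be an analytic perfectoid pair in characteristic $p$, let $\overline{x}_0,\dots,\overline{x}_m\in R^+$ be generators of an ideal of definition of $R^+$, and let $\rho\in(0,1)$. Then the weighted Gauss norm \[ \Big|\sum_{n=0}^{\infty}p^{n}[\overline{y}_{n}] \Big|_{\rho} = \sup_{n\ge 0} \{ \rho^{n}|\overline{y}_{n}| \} \] on $W(R^{+})$ defines the $(p, [\overline{x}_{0}],\dots,[\overline{x}_{m}])$-adic topology.
   Context: A Huber ring is a complete topological ring $A$ with an open subring $A_0$ carrying the $I$-adic topology for a finitely generated ideal $I\subset A_0$. A uniform (power-bounded elements form a bounded set) analytic (topologically nilpotent elements generate the unit ideal) Huber pair $(A,A^+)$ is an analytic perfectoid pair if there is an ideal of definition $I\subset A^+$ with $p\in I^p$ and Frobenius $A^+/I\to A^+/I^p$ surjective. $R$ is perfect of characteristic $p$; it is regarded as a Banach ring with a power-multiplicative norm $|\cdot|$ defining its topology. $[\cdot]$ denotes the Teichmüller lift, and each element of $W(R^+)$ is uniquely $\sum_n p^n[\overline{y}_n]$ with $\overline{y}_n\in R^+$. -}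

module Defs where

open import Level using (Level; 0ℓ) renaming (suc to lsuc; _⊔_ to _⊔ˡ_)
open import Algebra.Bundles using (CommutativeRing; Semiring)
open import Algebra.Morphism.Structures using (module RingMorphisms)
import Algebra.Definitions.RawSemiring as RawSemiringDefs
import Algebra.Properties.Ring as RingProperties
import Relation.Binary.Reasoning.Setoid as SetoidReasoning
open import Data.Fin.Base using (Fin; toℕ)
open import Data.Nat.Base as ℕ using (ℕ; zero; suc)
open import Data.Product.Base using (Σ; ∃; _×_; _,_; proj₁; proj₂)
open import Data.Rational.Base as ℚ using (ℚ; 0ℚ; 1ℚ)
import Data.Rational.Properties as ℚₚ
open import Data.Sum.Base using (inj₁; inj₂)
open import Data.Vec.Functional using (Vector)
open import Function.Base using (_∘_)
open import Function.Bundles using (_⇔_; module Equivalence)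
open import Relation.Binary.Definitions using (_Respects_)
open import Relation.Binary.PropositionalEquality.Core as ≡ using (subst)
open import Relation.Unary using (Pred; _∈_; _⊆_; _≐_; _∩_; ⋃)

private
  variable
    ℓ s t : Level

-- One-sided Dedekind cuts: x ∈ [0,∞] is represented by the set of rationals
-- q with x < q.  The empty cut is ∞, so that suprema always exist; the
-- non-negative real numbers are the finite elements.

record ℝ∞ : Set₁ where
  field
    Above    : Pred ℚ 0ℓ
    positive : ∀ {q} → Above q → 0ℚ ℚ.< q
    upward   : ∀ {q r} → q ℚ.≤ r → Above q → Above r
    rounded  : ∀ {q} → Above q → ∃ λ r → r ℚ.< q × Above r

open ℝ∞ public using (Above)

Finite : ℝ∞ → Set
Finite x = ∃ (Above x)

infix 4 _≤ᴿ_ _≈ᴿ_ _<ᴿ_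

_≤ᴿ_ : ℝ∞ → ℝ∞ → Set
x ≤ᴿ y = ∀ q → Above y q → Above x q

_≈ᴿ_ : ℝ∞ → ℝ∞ → Set
x ≈ᴿ y = x ≤ᴿ y × y ≤ᴿ x

_<ᴿ_ : ℝ∞ → ℝ∞ → Set
x <ᴿ y = ∃ λ q → Above x q × (∀ r → Above y r → q ℚ.≤ r)

fromℚ : (q : ℚ) → 0ℚ ℚ.≤ q → ℝ∞
fromℚ q 0≤q = record
  { Above    = q ℚ.<_
  ; positive = ℚₚ.≤-<-trans 0≤q
  ; upward   = λ r≤s q<r → ℚₚ.<-≤-trans q<r r≤s
  ; rounded  = λ q<r → let (m , q<m , m<r) = ℚₚ.<-dense q<r in m , m<r , q<m
  }

0ᴿ 1ᴿ : ℝ∞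
0ᴿ = fromℚ 0ℚ ℚₚ.≤-refl
1ᴿ = fromℚ 1ℚ (ℚₚ.nonNegative⁻¹ 1ℚ)

infixl 7 _*ᴿ_
infixl 6 _⊔ᴿ_
infixr 8 _^ᴿ_

_*ᴿ_ : ℝ∞ → ℝ∞ → ℝ∞
x *ᴿ y = record
  { Above    = λ q → ∃ λ a → ∃ λ b → Above x a × Above y b × a ℚ.* b ℚ.≤ q
  ; positive = λ (a , b , x<a , y<b , ab≤q) →
      let instance
            a>0 : ℚ.Positive a
            a>0 = ℚ.positive (ℝ∞.positive x x<a)
            b>0 : ℚ.Positive b
            b>0 = ℚ.positive (ℝ∞.positive y y<b)
      in ℚₚ.<-≤-trans (ℚₚ.positive⁻¹ (a ℚ.* b) {{ℚₚ.pos*pos⇒pos a b}}) ab≤q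
  ; upward   = λ q≤r (a , b , x<a , y<b , ab≤q) →
      a , b , x<a , y<b , ℚₚ.≤-trans ab≤q q≤r
  ; rounded  = λ (a , b , x<a , y<b , ab≤q) →
      let (c , c<a , x<c) = ℝ∞.rounded x x<a
          cb<ab = ℚₚ.*-monoˡ-<-pos b {{ℚ.positive (ℝ∞.positive y y<b)}} c<a
      in c ℚ.* b , ℚₚ.<-≤-trans cb<ab ab≤q , c , b , x<c , y<b , ℚₚ.≤-refl
  }

_^ᴿ_ : ℝ∞ → ℕ → ℝ∞
x ^ᴿ zero  = 1ᴿ
x ^ᴿ suc n = x *ᴿ x ^ᴿ n

_⊔ᴿ_ : ℝ∞ → ℝ∞ → ℝ∞
x ⊔ᴿ y = record
  { Above    = λ q → Above x q × Above y q
  ; positive = λ (x<q , _) → ℝ∞.positive x x<q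
  ; upward   = λ q≤r (x<q , y<q) → ℝ∞.upward x q≤r x<q , ℝ∞.upward y q≤r y<q
  ; rounded  = λ {q} (x<q , y<q) →
      let (a , a<q , x<a) = ℝ∞.rounded x x<q
          (b , b<q , y<b) = ℝ∞.rounded y y<q
      in a ℚ.⊔ b
       , ⊔-< a b a<q b<q
       , ℝ∞.upward x (ℚₚ.p≤p⊔q a b) x<a
       , ℝ∞.upward y (ℚₚ.p≤q⊔p a b) y<b
  }
  where
  ⊔-< : ∀ {q} a b → a ℚ.< q → b ℚ.< q → a ℚ.⊔ b ℚ.< q
  ⊔-< {q} a b a<q b<q with ℚₚ.⊔-sel a b
  ... | inj₁ eq = subst (ℚ._< q) (≡.sym eq) a<q
  ... | inj₂ eq = subst (ℚ._< q) (≡.sym eq) b<q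

sup : (ℕ → ℝ∞) → ℝ∞
sup f = record
  { Above    = λ q → ∃ λ r → r ℚ.< q × (∀ n → Above (f n) r)
  ; positive = λ (r , r<q , f<r) → ℚₚ.<-trans (ℝ∞.positive (f 0) (f<r 0)) r<q
  ; upward   = λ q≤q′ (r , r<q , f<r) → r , ℚₚ.<-≤-trans r<q q≤q′ , f<r
  ; rounded  = λ (r , r<q , f<r) →
      let (m , r<m , m<q) = ℚₚ.<-dense r<q in m , m<q , r , r<m , f<r
  }

-- Families of subsets of X: the open sets of a topology, or a filter.
Opens : Set ℓ → (t : Level) → Set (lsuc ℓ ⊔ˡ lsuc t)
Opens {ℓ} X t = Pred (Pred X ℓ) t

infix 4 _≋_

_≋_ : {X : Set ℓ} → Opens X s → Opens X t → Set (lsuc ℓ ⊔ˡ s ⊔ˡ t)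
𝒪 ≋ 𝒪′ = ∀ V → V ∈ 𝒪 ⇔ V ∈ 𝒪′

module Ring (R : CommutativeRing ℓ ℓ) where

  open CommutativeRing R public hiding (zero)
  open RawSemiringDefs (Semiring.rawSemiring (CommutativeRing.semiring R)) public using (_^_; sum)
    renaming (_×_ to _·_)

  fromℕ : ℕ → Carrier
  fromℕ n = n · 1#

  data Span (S : Pred Carrier s) : Pred Carrier (ℓ ⊔ˡ s) where
    gen  : ∀ {x} → x ∈ S → x ∈ Span S
    zero : 0# ∈ Span S
    add  : ∀ {x y} → x ∈ Span S → y ∈ Span S → x + y ∈ Span S
    mul  : ∀ a {x} → x ∈ Span S → a * x ∈ Span S
    resp : ∀ {x y} → x ≈ y → x ∈ Span S → y ∈ Span S

  ⟨_⟩ : ∀ {n} → Vector Carrier n → Pred Carrier ℓ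
  ⟨ x ⟩ = Span (λ a → ∃ λ i → a ≈ x i)

  infixr 8 _^ᴵ_

  _^ᴵ_ : Pred Carrier ℓ → ℕ → Pred Carrier ℓ
  I ^ᴵ zero  = Span (1# ≈_)
  I ^ᴵ suc n = Span (λ a → ∃ λ x → ∃ λ y → x ∈ I × y ∈ I ^ᴵ n × a ≈ x * y)

  AdicOpen : Pred Carrier ℓ → Opens Carrier ℓ
  AdicOpen I V = ∀ x → x ∈ V → ∃ λ n → ∀ y → y - x ∈ I ^ᴵ n → y ∈ V

  NormOpen : (Carrier → ℝ∞) → Opens Carrier ℓ
  NormOpen ∥_∥ V =
    ∀ x → x ∈ V → ∃ λ ε → 0ℚ ℚ.< ε × (∀ y → Above ∥ y - x ∥ ε → y ∈ V)

  HasCharacteristic : ℕ → Set ℓ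
  HasCharacteristic p = fromℕ p ≈ 0#

  Perfect : ℕ → Set ℓ
  Perfect p = (∀ x y → x ^ p ≈ y ^ p → x ≈ y) × (∀ y → ∃ λ x → x ^ p ≈ y)

  record IsNorm (∥_∥ : Carrier → ℝ∞) : Set ℓ where
    field
      finite            : ∀ x → Finite ∥ x ∥
      cong              : ∀ {x y} → x ≈ y → ∥ x ∥ ≈ᴿ ∥ y ∥
      ∥0∥≈0             : ∥ 0# ∥ ≈ᴿ 0ᴿ
      ∥x∥≈0⇒x≈0         : ∀ x → ∥ x ∥ ≈ᴿ 0ᴿ → x ≈ 0#
      nonarchimedean    : ∀ x y → ∥ x - y ∥ ≤ᴿ ∥ x ∥ ⊔ᴿ ∥ y ∥
      submultiplicative : ∀ x y → ∥ x * y ∥ ≤ᴿ ∥ x ∥ *ᴿ ∥ y ∥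

  -- Only positive exponents, so as not to exclude the zero ring.
  PowerMultiplicative : (Carrier → ℝ∞) → Set ℓ
  PowerMultiplicative ∥_∥ = ∀ x n → ∥ x ^ suc n ∥ ≈ᴿ ∥ x ∥ ^ᴿ suc n

record Subring (R : CommutativeRing ℓ ℓ) : Set (lsuc ℓ) where
  open Ring R
  field
    Member   : Pred Carrier ℓ
    resp-≈   : Member Respects _≈_
    +-closed : ∀ {x y} → x ∈ Member → y ∈ Member → x + y ∈ Member
    *-closed : ∀ {x y} → x ∈ Member → y ∈ Member → x * y ∈ Member
    -‿closed : ∀ {x} → x ∈ Member → - x ∈ Member
    0-closed : 0# ∈ Member
    1-closed : 1# ∈ Member

  asRing : CommutativeRing ℓ ℓ
  asRing = record
    { Carrier = Σ Carrier Member
    ; _≈_     = λ x y → proj₁ x ≈ proj₁ y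
    ; _+_     = λ (x , x∈) (y , y∈) → x + y , +-closed x∈ y∈
    ; _*_     = λ (x , x∈) (y , y∈) → x * y , *-closed x∈ y∈
    ; -_      = λ (x , x∈) → - x , -‿closed x∈
    ; 0#      = 0# , 0-closed
    ; 1#      = 1# , 1-closed
    ; isCommutativeRing = record
      { isRing = record
        { +-isAbelianGroup = record
          { isGroup = record
            { isMonoid = record
              { isSemigroup = record
                { isMagma = record
                  { isEquivalence = record
                    { refl = Ring.refl R ; sym = Ring.sym R ; trans = Ring.trans R }
                  ; ∙-cong = +-cong
                  }
                ; assoc = λ x y z → +-assoc (proj₁ x) (proj₁ y) (proj₁ z)
                }
              ; identity = (λ x → +-identityˡ (proj₁ x)) , (λ x → +-identityʳ (proj₁ x))
              }
            ; inverse = (λ x → -‿inverseˡ (proj₁ x)) , (λ x → -‿inverseʳ (proj₁ x))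
            ; ⁻¹-cong = -‿cong
            }
          ; comm = λ x y → +-comm (proj₁ x) (proj₁ y)
          }
        ; *-cong = *-cong
        ; *-assoc = λ x y z → *-assoc (proj₁ x) (proj₁ y) (proj₁ z)
        ; *-identity = (λ x → *-identityˡ (proj₁ x)) , (λ x → *-identityʳ (proj₁ x))
        ; distrib = (λ x y z → distribˡ (proj₁ x) (proj₁ y) (proj₁ z))
                  , (λ x y z → distribʳ (proj₁ x) (proj₁ y) (proj₁ z))
        }
      ; *-comm = λ x y → *-comm (proj₁ x) (proj₁ y)
      }
    }

record TopologicalRing (ℓ : Level) : Set (lsuc ℓ) where
  field
    commutativeRing : CommutativeRing ℓ ℓ

  open Ring commutativeRing public

  field
    Open : Opens Carrier ℓ

    open-resp-≈ : ∀ {V} → Open V → V Respects _≈_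
    open-resp-≐ : ∀ {V V′} → V ≐ V′ → Open V → Open V′
    open-U      : Open (λ x → x ≈ x)
    open-∩      : ∀ {V V′} → Open V → Open V′ → Open (V ∩ V′)
    open-⋃      : ∀ {I : Set ℓ} (V : I → Pred Carrier ℓ) →
                  (∀ i → Open (V i)) → Open (⋃ I V)

    +-continuous : ∀ {V} → Open V → ∀ x y → x + y ∈ V →
      ∃ λ V₁ → ∃ λ V₂ → Open V₁ × Open V₂ × x ∈ V₁ × y ∈ V₂ ×
        (∀ {a b} → a ∈ V₁ → b ∈ V₂ → a + b ∈ V)
    *-continuous : ∀ {V} → Open V → ∀ x y → x * y ∈ V →
      ∃ λ V₁ → ∃ λ V₂ → Open V₁ × Open V₂ × x ∈ V₁ × y ∈ V₂ ×
        (∀ {a b} → a ∈ V₁ → b ∈ V₂ → a * b ∈ V)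
    -‿continuous : ∀ {V} → Open V → Open (λ x → - x ∈ V)

module _ (A : TopologicalRing ℓ) where

  open TopologicalRing A

  record IsCauchyFilter (F : Opens Carrier (lsuc ℓ)) : Set (lsuc ℓ) where
    field
      inhabited : ∀ {V} → F V → ∃ V
      nonempty  : ∃ F
      upward    : ∀ {V V′} → V ⊆ V′ → F V → F V′
      ∩-closed  : ∀ {V V′} → F V → F V′ → F (V ∩ V′)
      cauchy    : ∀ {V} → Open V → 0# ∈ V →
                  ∃ λ S → F S × (∀ {x y} → x ∈ S → y ∈ S → x - y ∈ V)

  ConvergesTo : Opens Carrier (lsuc ℓ) → Carrier → Set (lsuc ℓ)
  ConvergesTo F x = ∀ {V} → Open V → x ∈ V → F V

  -- Uniqueness of limits: complete includes Hausdorff.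
  IsComplete : Set (lsuc (lsuc ℓ))
  IsComplete = ∀ F → IsCauchyFilter F →
    ∃ λ x → ConvergesTo F x × (∀ y → ConvergesTo F y → x ≈ y)

  Bounded : Pred Carrier s → Set (lsuc ℓ ⊔ˡ s)
  Bounded S = ∀ {V} → Open V → 0# ∈ V →
    ∃ λ V′ → Open V′ × 0# ∈ V′ × (∀ {a b} → a ∈ S → b ∈ V′ → a * b ∈ V)

  PowerBounded : Pred Carrier (lsuc ℓ)
  PowerBounded x = Bounded (λ a → ∃ λ n → a ≈ x ^ n)

  TopologicallyNilpotent : Pred Carrier (lsuc ℓ)
  TopologicallyNilpotent x = ∀ {V} → Open V → 0# ∈ V →
    ∃ λ n → ∀ m → n ℕ.≤ m → x ^ m ∈ V

  IsUniform : Set (lsuc ℓ)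
  IsUniform = Bounded PowerBounded

  IsAnalytic : Set (lsuc ℓ)
  IsAnalytic = 1# ∈ Span TopologicallyNilpotent

  module _ (B : Subring commutativeRing) where

    open Subring B using (Member)
    private module B = Ring (Subring.asRing B)

    SubspaceOpen : Opens B.Carrier (lsuc ℓ)
    SubspaceOpen V = ∃ λ V′ → Open V′ × V ≐ (V′ ∘ proj₁)

    GeneratesIdealOfDefinition : ∀ {n} → Vector B.Carrier n → Set (lsuc ℓ)
    GeneratesIdealOfDefinition x = SubspaceOpen ≋ B.AdicOpen B.⟨ x ⟩

    IsIntegrallyClosed : Set ℓ
    IsIntegrallyClosed = ∀ n (a : Vector Carrier n) → (∀ i → a i ∈ Member) →
      ∀ x → x ^ n + sum (λ i → a i * x ^ toℕ i) ≈ 0# → x ∈ Member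

  record IsHuberRing : Set (lsuc (lsuc ℓ)) where
    field
      complete : IsComplete
      A₀       : Subring commutativeRing
      A₀-open  : Open (Subring.Member A₀)
      {rank}   : ℕ
      I        : Vector (Ring.Carrier (Subring.asRing A₀)) rank
      I-adic   : GeneratesIdealOfDefinition A₀ I

  record IsHuberPair (A⁺ : Subring commutativeRing) : Set (lsuc (lsuc ℓ)) where
    open Subring A⁺ using (Member)
    field
      isHuberRing         : IsHuberRing
      A⁺-open             : Open Member
      A⁺-integrallyClosed : IsIntegrallyClosed A⁺
      A⁺-powerBounded     : Member ⊆ PowerBounded

  record IsAnalyticPerfectoidPair (p : ℕ) (A⁺ : Subring commutativeRing)
         : Set (lsuc (lsuc ℓ)) where
    private module A⁺ = Ring (Subring.asRing A⁺)
    field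
      isHuberPair : IsHuberPair A⁺
      uniform     : IsUniform
      analytic    : IsAnalytic
      {rank}      : ℕ
      I           : Vector A⁺.Carrier rank
      I-def       : GeneratesIdealOfDefinition A⁺ I
      p∈I^p       : A⁺.fromℕ p ∈ A⁺.⟨ I ⟩ A⁺.^ᴵ p
      -- Surjectivity of x ↦ x ^ p from A⁺ / I to A⁺ / I ^ p.
      frobenius   : ∀ y → ∃ λ x → y A⁺.- x A⁺.^ p ∈ A⁺.⟨ I ⟩ A⁺.^ᴵ p

-- For S perfect of characteristic p, W(S) is the strict p-ring with residue
-- ring S: it is p-torsion-free, p-adically complete and separated, and
-- W(S)/p ≅ S.  These properties determine W(S) up to unique isomorphism, and
-- the Teichmüller lift is then the unique multiplicative section of W(S) → S.

record WittVectors (p : ℕ) (S : CommutativeRing ℓ ℓ) : Set (lsuc ℓ) where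
  field
    commutativeRing : CommutativeRing ℓ ℓ

  private
    module S = Ring S
    module W = Ring commutativeRing
  open RingMorphisms (CommutativeRing.rawRing commutativeRing) (CommutativeRing.rawRing S)

  infix 4 _∣ᵂ_
  _∣ᵂ_ : W.Carrier → W.Carrier → Set ℓ
  a ∣ᵂ y = ∃ λ z → y W.≈ a W.* z

  field
    p-torsionFree : ∀ y → W.fromℕ p W.* y W.≈ W.0# → y W.≈ W.0#
    p-complete    : ∀ (y : ℕ → W.Carrier) →
      (∀ n → W.fromℕ p W.^ n ∣ᵂ y (suc n) W.- y n) →
      ∃ λ z → ∀ n → W.fromℕ p W.^ n ∣ᵂ z W.- y n
    p-separated   : ∀ y → (∀ n → W.fromℕ p W.^ n ∣ᵂ y) → y W.≈ W.0#

    reduce                : W.Carrier → S.Carrier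
    reduce-isHomomorphism : IsRingHomomorphism reduce
    reduce-kernel         : ∀ y → reduce y S.≈ S.0# ⇔ W.fromℕ p ∣ᵂ y

    [_]        : S.Carrier → W.Carrier
    []-cong    : ∀ {x y} → x S.≈ y → [ x ] W.≈ [ y ]
    []-*-homo  : ∀ x y → [ x S.* y ] W.≈ [ x ] W.* [ y ]
    []-1-homo  : [ S.1# ] W.≈ W.1#
    reduce-[]  : ∀ x → reduce [ x ] S.≈ x

  private
    π : W.Carrier
    π = W.fromℕ p

    reduce-remainder : ∀ y → reduce (y W.- [ reduce y ]) S.≈ S.0#
    reduce-remainder y = begin
      reduce (y W.- [ reduce y ])             ≈⟨ H.+-homo _ _ ⟩
      reduce y S.+ reduce (W.- [ reduce y ])  ≈⟨ S.+-congˡ (H.-‿homo _) ⟩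
      reduce y S.- reduce [ reduce y ]        ≈⟨ S.+-congˡ (S.-‿cong (reduce-[] _)) ⟩
      reduce y S.- reduce y                   ≈⟨ S.-‿inverseʳ _ ⟩
      S.0#                                    ∎
      where
      module H = IsRingHomomorphism reduce-isHomomorphism
      open SetoidReasoning S.setoid

    divisible : ∀ y → π ∣ᵂ y W.- [ reduce y ]
    divisible y = Equivalence.to (reduce-kernel _) (reduce-remainder y)

  -- y = [ reduce y ] + p * shift y
  shift : W.Carrier → W.Carrier
  shift y = proj₁ (divisible y)

  tail : W.Carrier → ℕ → W.Carrier
  tail y zero    = y
  tail y (suc n) = shift (tail y n)

  digit : W.Carrier → ℕ → S.Carrier
  digit y n = reduce (tail y n)

  partialSum : (ℕ → S.Carrier) → ℕ → W.Carrier
  partialSum d zero    = W.0#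
  partialSum d (suc n) = partialSum d n W.+ π W.^ n W.* [ d n ]

  -- y = Σₙ pⁿ [ d n ], the series converging p-adically.
  IsTeichmüllerExpansion : W.Carrier → (ℕ → S.Carrier) → Set ℓ
  IsTeichmüllerExpansion y d = ∀ n → π W.^ n ∣ᵂ y W.- partialSum d n

  private
    open SetoidReasoning W.setoid
    open RingProperties W.ring using (-0#≈0#; x[y-z]≈xy-xz; -‿+-comm; x∙y⁻¹≈ε⇒x≈y)

    split : ∀ d n y → y W.- partialSum d (suc n) W.≈
                      (y W.- partialSum d n) W.- π W.^ n W.* [ d n ]
    split d n y = begin
      y W.- (partialSum d n W.+ π W.^ n W.* [ d n ])
        ≈⟨ W.+-congˡ (-‿+-comm _ _) ⟨
      y W.+ (W.- partialSum d n W.- π W.^ n W.* [ d n ])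
        ≈⟨ W.+-assoc _ _ _ ⟨
      (y W.- partialSum d n) W.- π W.^ n W.* [ d n ] ∎

    factor : ∀ n a → π W.^ n W.* (π W.* a) W.≈ π W.^ suc n W.* a
    factor n a = begin
      π W.^ n W.* (π W.* a)  ≈⟨ W.*-assoc _ _ _ ⟨
      π W.^ n W.* π W.* a    ≈⟨ W.*-congʳ (W.*-comm _ _) ⟩
      π W.^ suc n W.* a      ∎

  digit-expansion : ∀ y n → y W.- partialSum (digit y) n W.≈ π W.^ n W.* tail y n
  digit-expansion y zero = begin
    y W.- W.0#     ≈⟨ W.+-congˡ -0#≈0# ⟩
    y W.+ W.0#     ≈⟨ W.+-identityʳ y ⟩
    y              ≈⟨ W.*-identityˡ y ⟨
    W.1# W.* y     ∎
  digit-expansion y (suc n) = begin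
    y W.- partialSum (digit y) (suc n)
      ≈⟨ split (digit y) n y ⟩
    (y W.- partialSum (digit y) n) W.- π W.^ n W.* [ digit y n ]
      ≈⟨ W.+-congʳ (digit-expansion y n) ⟩
    π W.^ n W.* tail y n W.- π W.^ n W.* [ digit y n ]
      ≈⟨ x[y-z]≈xy-xz _ _ _ ⟨
    π W.^ n W.* (tail y n W.- [ digit y n ])
      ≈⟨ W.*-congˡ (proj₂ (divisible (tail y n))) ⟩
    π W.^ n W.* (π W.* tail y (suc n))
      ≈⟨ factor n _ ⟩
    π W.^ suc n W.* tail y (suc n) ∎

  digit-isExpansion : ∀ y → IsTeichmüllerExpansion y (digit y)
  digit-isExpansion y n = tail y n , digit-expansion y n

  private
    cancel : ∀ n a b → π W.^ n W.* a W.≈ π W.^ n W.* b → a W.≈ b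
    cancel n a b eq = x∙y⁻¹≈ε⇒x≈y a b (go n (a W.- b) (begin
      π W.^ n W.* (a W.- b)              ≈⟨ x[y-z]≈xy-xz _ _ _ ⟩
      π W.^ n W.* a W.- π W.^ n W.* b    ≈⟨ W.+-congʳ eq ⟩
      π W.^ n W.* b W.- π W.^ n W.* b    ≈⟨ W.-‿inverseʳ _ ⟩
      W.0#                               ∎))
      where
      go : ∀ n c → π W.^ n W.* c W.≈ W.0# → c W.≈ W.0#
      go zero    c eq = W.trans (W.sym (W.*-identityˡ c)) eq
      go (suc n) c eq = p-torsionFree c (go n _ (W.trans (factor n c) eq))

    reduce-≈ : ∀ a x b → a W.- [ x ] W.≈ π W.* b → reduce a S.≈ x
    reduce-≈ a x b eq = S-≈ (reduce a) x (S.trans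
      (S.sym (S.trans (H.+-homo _ _) (S.+-congˡ (S.trans (H.-‿homo _) (S.-‿cong (reduce-[] x))))))
      (Equivalence.from (reduce-kernel _) (b , eq)))
      where
      module H = IsRingHomomorphism reduce-isHomomorphism
      open RingProperties S.ring renaming (x∙y⁻¹≈ε⇒x≈y to S-≈)

  mutual
    private
      partialSum-unique : ∀ {y d} → IsTeichmüllerExpansion y d →
                          ∀ n → partialSum (digit y) n W.≈ partialSum d n
      partialSum-unique e zero    = W.refl
      partialSum-unique e (suc n) = W.+-cong (partialSum-unique e n)
        (W.*-congˡ ([]-cong (digit-unique e n)))

    digit-unique : ∀ {y d} → IsTeichmüllerExpansion y d → ∀ n → digit y n S.≈ d n
    digit-unique {y} {d} e n = let (z , eq) = e (suc n) in
      reduce-≈ (tail y n) (d n) z (cancel n _ _ (begin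
        π W.^ n W.* (tail y n W.- [ d n ])
          ≈⟨ x[y-z]≈xy-xz _ _ _ ⟩
        π W.^ n W.* tail y n W.- π W.^ n W.* [ d n ]
          ≈⟨ W.+-congʳ (digit-expansion y n) ⟨
        (y W.- partialSum (digit y) n) W.- π W.^ n W.* [ d n ]
          ≈⟨ W.+-congʳ (W.+-congˡ (W.-‿cong (partialSum-unique e n))) ⟩
        (y W.- partialSum d n) W.- π W.^ n W.* [ d n ]
          ≈⟨ split d n y ⟨
        y W.- partialSum d (suc n)
          ≈⟨ eq ⟩
        π W.^ suc n W.* z
          ≈⟨ factor n z ⟨
        π W.^ n W.* (π W.* z) ∎))

  gaussNorm : (S.Carrier → ℝ∞) → ℝ∞ → W.Carrier → ℝ∞
  gaussNorm ∥_∥ ρ y = sup (λ n → ρ ^ᴿ n *ᴿ ∥ digit y n ∥)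

{-# OPTIONS --safe #-}

-- Write J = (p, [x₀], …, [xₘ]) and I = (x₀, …, xₘ).
--
-- Norm balls inside powers of J: if |y₀|, …, |yₙ₋₁| are small, then so are their pᵉ-th roots,
-- which therefore lie in I; their Teichmüller lifts lie in J, and raising these to the power
-- pᵉ ≥ n gives [yₖ] ∈ Jⁿ.
--
-- Powers of J inside norm balls: since |·| ≤ 1 on R⁺, only finitely many digits matter, and it
-- suffices that z ↦ (z - [z₀]) / p is J-adically continuous at 0.  For q = pᵉ, raising to the
-- power q is additive on J modulo p J^q, so the elements congruent to [α]^q for some α ∈ I
-- modulo p J^(q-1) form an ideal.  It contains the q-th powers of the generators of J, hence a
-- power of J; and an element z = [α]^q + p u of it has z₀ = α^q and (z - [z₀]) / p = u ∈ J^(q-1).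
module Submission where

open import Defs
open import Algebra.Bundles using (CommutativeRing)
open import Algebra.Morphism.Structures using (module RingMorphisms)
import Algebra.Properties.CommutativeSemiring.Binomial as Binomial
import Algebra.Properties.CommutativeSemiring.Exp as Exp
import Algebra.Properties.Monoid.Sum as Sum
import Algebra.Properties.Ring as RingProperties
import Algebra.Properties.Semiring.Mult as Mult
import Algebra.Solver.Ring.NaturalCoefficients.Default as SemiringSolver
open import Data.Fin.Base as Fin using (Fin; toℕ; inject₁)
import Data.Fin.Properties as Finₚ
open import Data.Integer.Base as ℤ using (+_; -[1+_])
import Data.Integer.Properties as ℤₚ
open import Data.Nat.Base as ℕ using (ℕ; zero; suc; _!)
open import Data.Nat.Combinatorics using (_C_; nCn≡1; k![n∸k]!∣n!)
open import Data.Nat.Combinatorics.Specification using (nCk≡n!/k![n-k]!)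
open import Data.Nat.Divisibility using (_∣_; divides; >⇒∤; m∣m*n)
open import Data.Nat.DivMod using (m/n*n≡m)
open import Data.Nat.Primality using (Prime; euclidsLemma; prime⇒nonTrivial; ¬prime[0])
import Data.Nat.Properties as ℕₚ
open import Data.Product.Base using (∃; _×_; _,_; proj₁; proj₂)
open import Data.Rational.Base as ℚ using (ℚ; 0ℚ; 1ℚ; ½; toℚᵘ)
import Data.Rational.Properties as ℚₚ
open import Data.Rational.Solver using (module +-*-Solver)
open import Data.Rational.Unnormalised.Base as ℚᵘ using (mkℚᵘ; *≡*; *<*)
import Data.Rational.Unnormalised.Properties as ℚᵘₚ
open import Data.Sum.Base using (inj₁; inj₂)
open import Data.Vec.Functional using (Vector; _∷_; []; replicate)
open import Function.Base using (id; _∘_)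
open import Function.Bundles using (mk⇔; module Equivalence)
open import Level using (Level; _⊔_; Lift; lift; lower)
open import Relation.Binary.PropositionalEquality as ≡ using (_≡_)
import Relation.Binary.Reasoning.Setoid as SetoidReasoning
open import Relation.Nullary using (¬_; yes; no; contradiction)
open import Relation.Unary using (Pred; _∈_; _⊆_)

private
  variable
    ℓ s t : Level

-- Rationals and cuts

module ℚRing = Ring ℚₚ.+-*-commutativeRing
open ℚRing using () renaming (_^_ to _^ℚ_; fromℕ to ℕ⇒ℚ)

2ℚ : ℚ
2ℚ = 1ℚ ℚ.+ 1ℚ

toℚᵘ-ℕ⇒ℚ : ∀ n → toℚᵘ (ℕ⇒ℚ n) ℚᵘ.≃ mkℚᵘ (+ n) 0
toℚᵘ-ℕ⇒ℚ zero    = ℚᵘₚ.≃-refl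
toℚᵘ-ℕ⇒ℚ (suc n) = ℚᵘₚ.≃-trans (ℚₚ.toℚᵘ-homo-+ 1ℚ (ℕ⇒ℚ n))
  (ℚᵘₚ.≃-trans (ℚᵘₚ.+-congʳ (toℚᵘ 1ℚ) (toℚᵘ-ℕ⇒ℚ n))
    (*≡* (≡.cong (λ k → (+ 1 ℤ.+ k) ℤ.* + 1) (ℤₚ.*-identityʳ (+ n)))))

-- Archimedean property: the denominator is at least 1, so the absolute value of the numerator plus
-- one is large enough.
<-ℕ⇒ℚ : ∀ x → ∃ λ n → x ℚ.< ℕ⇒ℚ n
<-ℕ⇒ℚ x@(ℚ.mkℚ a d _) = suc ℤ.∣ a ∣ , ℚₚ.toℚᵘ-cancel-<
  (ℚᵘₚ.<-respʳ-≃ (ℚᵘₚ.≃-sym (toℚᵘ-ℕ⇒ℚ (suc ℤ.∣ a ∣))) (*<* (begin-strict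
    a ℤ.* + 1                     ≡⟨ ℤₚ.*-identityʳ a ⟩
    a                             ≤⟨ i≤∣i∣ a ⟩
    + ℤ.∣ a ∣                     <⟨ ℤ.+<+ (ℕₚ.n<1+n _) ⟩
    + suc ℤ.∣ a ∣                 ≤⟨ ℤ.+≤+ (ℕₚ.m≤m*n (suc ℤ.∣ a ∣) (suc d)) ⟩
    + suc ℤ.∣ a ∣ ℤ.* + suc d     ∎)))
  where
  open ℤₚ.≤-Reasoning
  i≤∣i∣ : ∀ i → i ℤ.≤ + ℤ.∣ i ∣
  i≤∣i∣ (+ n)    = ℤₚ.≤-refl
  i≤∣i∣ -[1+ n ] = ℤ.-≤+

*-mono-≤-pos : ∀ {a b c d} → 0ℚ ℚ.≤ a → 0ℚ ℚ.≤ d → a ℚ.≤ b → c ℚ.≤ d → a ℚ.* c ℚ.≤ b ℚ.* d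
*-mono-≤-pos {a} {b} {c} {d} 0≤a 0≤d a≤b c≤d = ℚₚ.≤-trans
  (ℚₚ.*-monoˡ-≤-nonNeg a {{ℚ.nonNegative 0≤a}} c≤d)
  (ℚₚ.*-monoʳ-≤-nonNeg d {{ℚ.nonNegative 0≤d}} a≤b)

*-pos : ∀ {a b} → 0ℚ ℚ.< a → 0ℚ ℚ.< b → 0ℚ ℚ.< a ℚ.* b
*-pos {a} {b} 0<a 0<b =
  ℚₚ.positive⁻¹ (a ℚ.* b) {{ℚₚ.pos*pos⇒pos a {{ℚ.positive 0<a}} b {{ℚ.positive 0<b}}}}

0<1 : 0ℚ ℚ.< 1ℚ
0<1 = ℚₚ.positive⁻¹ 1ℚ

1<2 : 1ℚ ℚ.< 2ℚ
1<2 = ℚ.*<* (ℤ.+<+ (ℕ.s≤s (ℕ.s≤s ℕ.z≤n)))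

^-pos : ∀ {a} → 0ℚ ℚ.< a → ∀ n → 0ℚ ℚ.< a ^ℚ n
^-pos 0<a zero    = 0<1
^-pos 0<a (suc n) = *-pos 0<a (^-pos 0<a n)

^-mono-≤ : ∀ {a b} → 0ℚ ℚ.< a → a ℚ.≤ b → ∀ n → a ^ℚ n ℚ.≤ b ^ℚ n
^-mono-≤ 0<a a≤b zero    = ℚₚ.≤-refl
^-mono-≤ 0<a a≤b (suc n) = *-mono-≤-pos (ℚₚ.<⇒≤ 0<a)
  (ℚₚ.<⇒≤ (^-pos (ℚₚ.<-≤-trans 0<a a≤b) n)) a≤b (^-mono-≤ 0<a a≤b n)

^-cancel-≤ : ∀ {a b} → 0ℚ ℚ.< b → ∀ n → a ^ℚ suc n ℚ.≤ b ^ℚ suc n → a ℚ.≤ b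
^-cancel-≤ {a} {b} 0<b n a^n≤b^n with a ℚₚ.≤? b
... | yes a≤b = a≤b
... | no  a≰b = contradiction (ℚₚ.<-≤-trans (ℚₚ.<-≤-trans
    (ℚₚ.*-monoˡ-<-pos (b ^ℚ n) {{ℚ.positive (^-pos 0<b n)}} b<a)
    (ℚₚ.*-monoˡ-≤-nonNeg a {{ℚ.nonNegative (ℚₚ.<⇒≤ (ℚₚ.<-trans 0<b b<a))}}
      (^-mono-≤ 0<b (ℚₚ.<⇒≤ b<a) n)))
    a^n≤b^n) (ℚₚ.<-irrefl ≡.refl)
  where b<a = ℚₚ.≰⇒> a≰b

^-≤1 : ∀ {a} → 0ℚ ℚ.< a → a ℚ.≤ 1ℚ → ∀ n → a ^ℚ n ℚ.≤ 1ℚ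
^-≤1 0<a a≤1 zero    = ℚₚ.≤-refl
^-≤1 0<a a≤1 (suc n) = *-mono-≤-pos (ℚₚ.<⇒≤ 0<a) (ℚₚ.<⇒≤ 0<1) a≤1 (^-≤1 0<a a≤1 n)

^-antitone : ∀ {a} → 0ℚ ℚ.< a → a ℚ.≤ 1ℚ → ∀ {m n} → m ℕ.≤ n → a ^ℚ n ℚ.≤ a ^ℚ m
^-antitone 0<a a≤1 {n = n} ℕ.z≤n     = ^-≤1 0<a a≤1 n
^-antitone {a} 0<a a≤1     (ℕ.s≤s l) =
  ℚₚ.*-monoˡ-≤-nonNeg a {{ℚ.nonNegative (ℚₚ.<⇒≤ 0<a)}} (^-antitone 0<a a≤1 l)

ℕ⇒ℚ-nonNeg : ∀ n → 0ℚ ℚ.≤ ℕ⇒ℚ n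
ℕ⇒ℚ-nonNeg zero    = ℚₚ.≤-refl
ℕ⇒ℚ-nonNeg (suc n) = ℚₚ.+-mono-≤ (ℚₚ.<⇒≤ 0<1) (ℕ⇒ℚ-nonNeg n)

bernoulli : ∀ {h} → 0ℚ ℚ.≤ h → ∀ n → 1ℚ ℚ.+ ℕ⇒ℚ n ℚ.* h ℚ.≤ (1ℚ ℚ.+ h) ^ℚ n
bernoulli {h} 0≤h zero    = ℚₚ.≤-reflexive (≡.cong (1ℚ ℚ.+_) (ℚₚ.*-zeroˡ h))
bernoulli {h} 0≤h (suc n) = begin
  1ℚ ℚ.+ ℕ⇒ℚ (suc n) ℚ.* h
    ≡⟨ ℚₚ.+-identityʳ _ ⟨
  1ℚ ℚ.+ ℕ⇒ℚ (suc n) ℚ.* h ℚ.+ 0ℚ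
    ≤⟨ ℚₚ.+-monoʳ-≤ (1ℚ ℚ.+ ℕ⇒ℚ (suc n) ℚ.* h) (ℚₚ.nonNegative⁻¹ _ {{nonNeg-hNh}}) ⟩
  1ℚ ℚ.+ ℕ⇒ℚ (suc n) ℚ.* h ℚ.+ h ℚ.* (ℕ⇒ℚ n ℚ.* h)
    ≡⟨ solve 2 (λ N h → con 1ℚ :+ (con 1ℚ :+ N) :* h :+ h :* (N :* h) :=
                        (con 1ℚ :+ h) :* (con 1ℚ :+ N :* h)) ≡.refl (ℕ⇒ℚ n) h ⟩
  (1ℚ ℚ.+ h) ℚ.* (1ℚ ℚ.+ ℕ⇒ℚ n ℚ.* h)
    ≤⟨ ℚₚ.*-monoˡ-≤-nonNeg (1ℚ ℚ.+ h) {{ℚ.nonNegative (ℚₚ.+-mono-≤ (ℚₚ.<⇒≤ 0<1) 0≤h)}}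
         (bernoulli 0≤h n) ⟩
  (1ℚ ℚ.+ h) ^ℚ suc n ∎
  where
  open ℚₚ.≤-Reasoning
  open +-*-Solver
  nonNeg-hNh : ℚ.NonNegative (h ℚ.* (ℕ⇒ℚ n ℚ.* h))
  nonNeg-hNh = ℚₚ.nonNeg*nonNeg⇒nonNeg h {{ℚ.nonNegative 0≤h}} (ℕ⇒ℚ n ℚ.* h)
    {{ℚₚ.nonNeg*nonNeg⇒nonNeg (ℕ⇒ℚ n) {{ℚ.nonNegative (ℕ⇒ℚ-nonNeg n)}} h {{ℚ.nonNegative 0≤h}}}}

-- Bernoulli's inequality with `h = a - 1` and a natural number `n > c / h`. The exponent is then
-- raised to `suc n` because roots of cuts are extracted only for positive exponents.
^-unbounded : ∀ {a} → 1ℚ ℚ.< a → ∀ c → ∃ λ n → c ℚ.< a ^ℚ suc n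
^-unbounded {a} 1<a c = n , (begin-strict
  c                         ≡⟨ ℚₚ.*-identityʳ c ⟨
  c ℚ.* 1ℚ                  ≡⟨ ≡.cong (c ℚ.*_) (ℚₚ.*-inverseˡ h) ⟨
  c ℚ.* (ℚ.1/ h ℚ.* h)      ≡⟨ ℚₚ.*-assoc c (ℚ.1/ h) h ⟨
  c ℚ.* ℚ.1/ h ℚ.* h        <⟨ ℚₚ.*-monoˡ-<-pos h c/h<n ⟩
  ℕ⇒ℚ n ℚ.* h               ≡⟨ ℚₚ.+-identityˡ _ ⟨
  0ℚ ℚ.+ ℕ⇒ℚ n ℚ.* h        ≤⟨ ℚₚ.+-monoˡ-≤ (ℕ⇒ℚ n ℚ.* h) (ℚₚ.<⇒≤ 0<1) ⟩
  1ℚ ℚ.+ ℕ⇒ℚ n ℚ.* h        ≤⟨ bernoulli (ℚₚ.<⇒≤ 0<h) n ⟩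
  (1ℚ ℚ.+ h) ^ℚ n           ≡⟨ ≡.cong (_^ℚ n) 1+h≡a ⟩
  a ^ℚ n                    ≡⟨ ℚₚ.*-identityˡ _ ⟨
  1ℚ ℚ.* a ^ℚ n             ≤⟨ ℚₚ.*-monoʳ-≤-nonNeg (a ^ℚ n)
                                 {{ℚ.nonNegative (ℚₚ.<⇒≤ (^-pos (ℚₚ.<-trans 0<1 1<a) n))}} (ℚₚ.<⇒≤ 1<a) ⟩
  a ^ℚ suc n                ∎)
  where
  open ℚₚ.≤-Reasoning
  open +-*-Solver
  h = a ℚ.- 1ℚ
  0<h : 0ℚ ℚ.< h
  0<h = ℚₚ.+-monoˡ-< (ℚ.- 1ℚ) 1<a
  1+h≡a : 1ℚ ℚ.+ h ≡ a
  1+h≡a = solve 1 (λ a → con 1ℚ :+ (a :- con 1ℚ) := a) ≡.refl a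
  instance
    h-pos : ℚ.Positive h
    h-pos = ℚ.positive 0<h
    h-nonZero : ℚ.NonZero h
    h-nonZero = ℚₚ.pos⇒nonZero h
  n = proj₁ (<-ℕ⇒ℚ (c ℚ.* ℚ.1/ h))
  c/h<n = proj₂ (<-ℕ⇒ℚ (c ℚ.* ℚ.1/ h))

-- Unboundedness of the powers of `1 / a`, compared with `1 / c`.
^-vanishes : ∀ {a} → 0ℚ ℚ.< a → a ℚ.< 1ℚ → ∀ {c} → 0ℚ ℚ.< c → ∃ λ n → a ^ℚ n ℚ.≤ c
^-vanishes {a} 0<a a<1 {c} 0<c =
  suc n , ℚₚ.*-cancelʳ-≤-pos (b ^ℚ suc n) {{ℚ.positive 0<b^n}} (begin
    a ^ℚ suc n ℚ.* b ^ℚ suc n  ≡⟨ ^-distrib-* a b (suc n) ⟨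
    (a ℚ.* b) ^ℚ suc n         ≡⟨ ≡.cong (_^ℚ suc n) (ℚₚ.*-inverseʳ a) ⟩
    1ℚ ^ℚ suc n                ≤⟨ ^-≤1 0<1 ℚₚ.≤-refl (suc n) ⟩
    1ℚ                         ≡⟨ ℚₚ.*-inverseʳ c ⟨
    c ℚ.* ℚ.1/ c               ≤⟨ ℚₚ.*-monoˡ-≤-nonNeg c {{ℚ.nonNegative (ℚₚ.<⇒≤ 0<c)}} (ℚₚ.<⇒≤ c⁻¹<b^n) ⟩
    c ℚ.* b ^ℚ suc n           ∎)
  where
  open ℚₚ.≤-Reasoning
  open Exp (CommutativeRing.commutativeSemiring ℚₚ.+-*-commutativeRing) using (^-distrib-*)
  instance
    a-pos : ℚ.Positive a
    a-pos = ℚ.positive 0<a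
    a-nonZero : ℚ.NonZero a
    a-nonZero = ℚₚ.pos⇒nonZero a
    c-nonZero : ℚ.NonZero c
    c-nonZero = ℚₚ.pos⇒nonZero c {{ℚ.positive 0<c}}
    b-pos : ℚ.Positive (ℚ.1/ a)
    b-pos = ℚₚ.1/pos⇒pos a
  b = ℚ.1/ a
  1<b : 1ℚ ℚ.< b
  1<b = ≡.subst₂ ℚ._<_ (ℚₚ.*-inverseʳ a) (ℚₚ.*-identityˡ b) (ℚₚ.*-monoˡ-<-pos b a<1)
  n = proj₁ (^-unbounded 1<b (ℚ.1/ c))
  c⁻¹<b^n = proj₂ (^-unbounded 1<b (ℚ.1/ c))
  0<b^n = ^-pos (ℚₚ.positive⁻¹ b) (suc n)

-- A bound on a product of cuts comes with a separate bound for each factor; the smallest of these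
-- serves for all factors at once.
^ᴿ-above⇒base-above : ∀ x n {c} → Above (x ^ᴿ suc n) c → ∃ λ a → Above x a × a ^ℚ suc n ℚ.≤ c
-- The first power is `x *ᴿ 1ᴿ`, so the second bound exceeds 1 and `a ≤ a * b`.
^ᴿ-above⇒base-above x zero {c} (a , b , x<a , 1<b , ab≤c) = a , x<a ,
  ℚₚ.≤-trans (ℚₚ.*-monoˡ-≤-nonNeg a {{ℚ.nonNegative (ℚₚ.<⇒≤ (ℝ∞.positive x x<a))}} (ℚₚ.<⇒≤ 1<b)) ab≤c
^ᴿ-above⇒base-above x (suc n) {c} (a , b , x<a , xⁿ<b , ab≤c)
  with ^ᴿ-above⇒base-above x n xⁿ<b
... | a′ , x<a′ , a′ⁿ≤b with ℚₚ.≤-total a a′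
... | inj₁ a≤a′ = a , x<a , ℚₚ.≤-trans
  (ℚₚ.*-monoˡ-≤-nonNeg a {{ℚ.nonNegative (ℚₚ.<⇒≤ 0<a)}} (ℚₚ.≤-trans (^-mono-≤ 0<a a≤a′ (suc n)) a′ⁿ≤b)) ab≤c
  where 0<a = ℝ∞.positive x x<a
... | inj₂ a′≤a = a′ , x<a′ , ℚₚ.≤-trans
  (*-mono-≤-pos (ℚₚ.<⇒≤ 0<a′) (ℚₚ.≤-trans (ℚₚ.<⇒≤ (^-pos 0<a′ (suc n))) a′ⁿ≤b) a′≤a a′ⁿ≤b) ab≤c
  where 0<a′ = ℝ∞.positive x x<a′

^ᴿ-above-cancel : ∀ x n {c} → 0ℚ ℚ.< c → Above (x ^ᴿ suc n) (c ^ℚ suc n) → Above x c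
^ᴿ-above-cancel x n 0<c xⁿ<cⁿ =
  let (a , x<a , aⁿ≤cⁿ) = ^ᴿ-above⇒base-above x n xⁿ<cⁿ
  in ℝ∞.upward x (^-cancel-≤ 0<c n aⁿ≤cⁿ) x<a

-- For `q > 1` some power of q exceeds c and hence bounds the same power of x; taking roots gives
-- `x < q`.
^ᴿ-bounded⇒≤1 : ∀ x c → (∀ n → Above (x ^ᴿ suc n) c) → x ≤ᴿ 1ᴿ
^ᴿ-bounded⇒≤1 x c xⁿ<c q 1<q =
  let (n , c<qⁿ) = ^-unbounded 1<q c
  in ^ᴿ-above-cancel x n (ℚₚ.<-trans 0<1 1<q) (ℝ∞.upward (x ^ᴿ suc n) (ℚₚ.<⇒≤ c<qⁿ) (xⁿ<c n))

-- The factor 2 is there because no power q ^ n is strictly above x ^ᴿ 0 = 1.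
^ᴿ-above : ∀ x {q} → Above x q → ∀ n → Above (x ^ᴿ n) (2ℚ ℚ.* q ^ℚ n)
^ᴿ-above x {q} x<q zero    = 1<2
^ᴿ-above x {q} x<q (suc n) = q , 2ℚ ℚ.* q ^ℚ n , x<q , ^ᴿ-above x x<q n ,
  ℚₚ.≤-reflexive (solve 2 (λ q r → q :* (con 2ℚ :* r) := con 2ℚ :* (q :* r)) ≡.refl q (q ^ℚ n))
  where open +-*-Solver

^ᴿ-lowerBound : ∀ x {q} → 0ℚ ℚ.< q → (∀ r → Above x r → q ℚ.≤ r) →
                ∀ n r → Above (x ^ᴿ n) r → q ^ℚ n ℚ.≤ r
^ᴿ-lowerBound x 0<q q≤x zero    r 1<r = ℚₚ.<⇒≤ 1<r
^ᴿ-lowerBound x 0<q q≤x (suc n) r (a , b , x<a , xⁿ<b , ab≤r) = ℚₚ.≤-trans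
  (*-mono-≤-pos (ℚₚ.<⇒≤ 0<q) (ℚₚ.<⇒≤ (ℝ∞.positive (x ^ᴿ n) xⁿ<b)) (q≤x a x<a) (^ᴿ-lowerBound x 0<q q≤x n b xⁿ<b)) ab≤r

-- Divisibility of binomial coefficients by a prime

prime∤! : ∀ {p} → Prime p → ∀ k → k ℕ.< p → ¬ p ∣ k !
prime∤! {p} pp zero    k<p p∣1  = >⇒∤ (ℕ.nonTrivial⇒n>1 p {{prime⇒nonTrivial pp}}) p∣1
prime∤! {p} pp (suc k) k<p p∣k! with euclidsLemma (suc k) (k !) pp p∣k!
... | inj₁ p∣1+k = >⇒∤ k<p p∣1+k
... | inj₂ p∣k!′ = prime∤! pp k (ℕₚ.<-trans (ℕₚ.n<1+n k) k<p) p∣k!′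

-- The prime p divides `p ! = (p C k) * (k ! * (p - k) !)`, but neither of the two smaller
-- factorials.
prime∣C : ∀ {p} → Prime p → ∀ k → 0 ℕ.< k → k ℕ.< p → p ∣ p C k
prime∣C {zero}      pp k 0<k k<p = contradiction pp ¬prime[0]
prime∣C {p@(suc n)} pp k 0<k k<p with euclidsLemma (p C k) (k ! ℕ.* (p ℕ.∸ k) !) pp p∣p!
  where
  k≤p = ℕₚ.<⇒≤ k<p
  instance _ = k ℕₚ.!* (p ℕ.∸ k) !≢0
  p∣p! : p ∣ (p C k) ℕ.* (k ! ℕ.* (p ℕ.∸ k) !)
  p∣p! = ≡.subst (p ∣_) (≡.sym (≡.trans
    (≡.cong (ℕ._* (k ! ℕ.* (p ℕ.∸ k) !)) (nCk≡n!/k![n-k]! k≤p)) (m/n*n≡m (k![n∸k]!∣n! k≤p))))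
    (m∣m*n (n !))
... | inj₁ p∣C = p∣C
... | inj₂ p∣k![p∸k]! with euclidsLemma (k !) ((p ℕ.∸ k) !) pp p∣k![p∸k]!
... | inj₁ p∣k!     = contradiction p∣k! (prime∤! pp k k<p)
... | inj₂ p∣[p∸k]! = contradiction p∣[p∸k]! (prime∤! pp (p ℕ.∸ k) (ℕₚ.∸-monoʳ-< 0<k (ℕₚ.<⇒≤ k<p)))

-- Ideals and their powers

module Ideals (R : CommutativeRing ℓ ℓ) where

  open Ring R
  open Exp (CommutativeRing.commutativeSemiring R) hiding (_^_)
  open RingProperties (CommutativeRing.ring R) using (-1*x≈-x; //-rightDividesˡ)
  open Mult (CommutativeRing.semiring R) using (×-congʳ; ×-assocˡ; ×-assoc-*)
  open SetoidReasoning setoid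
  open SemiringSolver (CommutativeRing.commutativeSemiring R) using (solve; con; _:+_; _:*_; _:=_)

  record IsIdeal (T : Pred Carrier t) : Set (ℓ ⊔ t) where
    field
      zero∈ : 0# ∈ T
      add∈  : ∀ {x y} → x ∈ T → y ∈ T → x + y ∈ T
      mul∈  : ∀ a {x} → x ∈ T → a * x ∈ T
      resp∈ : ∀ {x y} → x ≈ y → x ∈ T → y ∈ T

    neg∈ : ∀ {x} → x ∈ T → - x ∈ T
    neg∈ x∈T = resp∈ (-1*x≈-x _) (mul∈ (- 1#) x∈T)

    sum∈ : ∀ {n} (v : Vector Carrier n) → (∀ i → v i ∈ T) → sum v ∈ T
    sum∈ {zero}  v v∈T = zero∈
    sum∈ {suc n} v v∈T = add∈ (v∈T Fin.zero) (sum∈ (v ∘ Fin.suc) (v∈T ∘ Fin.suc))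

  open IsIdeal

  span-isIdeal : (S : Pred Carrier s) → IsIdeal (Span S)
  span-isIdeal S = record { zero∈ = zero ; add∈ = add ; mul∈ = mul ; resp∈ = resp }

  span-least : {S : Pred Carrier s} {T : Pred Carrier t} → IsIdeal T → S ⊆ T → Span S ⊆ T
  span-least idl S⊆T (gen x∈S)   = S⊆T x∈S
  span-least idl S⊆T zero        = zero∈ idl
  span-least idl S⊆T (add x y)   = add∈ idl (span-least idl S⊆T x) (span-least idl S⊆T y)
  span-least idl S⊆T (mul a x)   = mul∈ idl a (span-least idl S⊆T x)
  span-least idl S⊆T (resp eq x) = resp∈ idl eq (span-least idl S⊆T x)

  -- The colon ideal `T : c`. With `span-least` it reduces a claim about `c * x`, for x in a span,
  -- to the generators of that span.
  colon-isIdeal : {T : Pred Carrier t} → IsIdeal T → ∀ c → IsIdeal (λ x → c * x ∈ T)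
  colon-isIdeal idl c = record
    { zero∈ = resp∈ idl (sym (zeroʳ c)) (zero∈ idl)
    ; add∈  = λ x y → resp∈ idl (sym (distribˡ c _ _)) (add∈ idl x y)
    ; mul∈  = λ a {x} cx → resp∈ idl (solve 3 (λ a c x → a :* (c :* x) := c :* (a :* x)) refl a c x) (mul∈ idl a cx)
    ; resp∈ = λ eq → resp∈ idl (*-congˡ eq)
    }

  infixr 7 _·ᴵ_
  _·ᴵ_ : Carrier → Pred Carrier t → Pred Carrier (ℓ ⊔ t)
  (c ·ᴵ T) x = ∃ λ u → u ∈ T × x ≈ c * u

  ·ᴵ-isIdeal : ∀ c {T : Pred Carrier t} → IsIdeal T → IsIdeal (c ·ᴵ T)
  ·ᴵ-isIdeal c idl = record
    { zero∈ = 0# , zero∈ idl , sym (zeroʳ c)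
    ; add∈  = λ (u , u∈ , x≈) (v , v∈ , y≈) →
        u + v , add∈ idl u∈ v∈ , trans (+-cong x≈ y≈) (sym (distribˡ c u v))
    ; mul∈  = λ a (u , u∈ , x≈) → a * u , mul∈ idl a u∈ ,
        trans (*-congˡ x≈) (solve 3 (λ a c x → a :* (c :* x) := c :* (a :* x)) refl a c u)
    ; resp∈ = λ eq (u , u∈ , x≈) → u , u∈ , trans (sym eq) x≈
    }

  ^ᴵ-isIdeal : ∀ I n → IsIdeal (I ^ᴵ n)
  ^ᴵ-isIdeal I zero    = span-isIdeal _
  ^ᴵ-isIdeal I (suc n) = span-isIdeal _

  ^ᴵ-* : ∀ I m n {x y} → x ∈ I ^ᴵ m → y ∈ I ^ᴵ n → x * y ∈ I ^ᴵ (m ℕ.+ n)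
  ^ᴵ-* I m n {x} {y} x∈ y∈ = resp∈ idl (*-comm y x) (go m x∈)
    where
    idl = ^ᴵ-isIdeal I (m ℕ.+ n)
    go : ∀ m {x} → x ∈ I ^ᴵ m → y * x ∈ I ^ᴵ (m ℕ.+ n)
    go zero    = span-least (colon-isIdeal (^ᴵ-isIdeal I n) y)
      (λ 1≈x → resp∈ (^ᴵ-isIdeal I n) (trans (sym (*-identityʳ y)) (*-congˡ 1≈x)) y∈)
    go (suc m) = span-least (colon-isIdeal (^ᴵ-isIdeal I (suc m ℕ.+ n)) y)
      (λ {x} (a , b , a∈I , b∈ , x≈ab) → gen (a , y * b , a∈I , go m b∈ ,
        trans (*-congˡ x≈ab) (solve 3 (λ a b y → y :* (a :* b) := a :* (y :* b)) refl a b y)))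

  1∈^ᴵ0 : ∀ I → 1# ∈ I ^ᴵ 0
  1∈^ᴵ0 I = gen refl

  ∈⇒∈^ᴵ1 : ∀ {I x} → x ∈ I → x ∈ I ^ᴵ 1
  ∈⇒∈^ᴵ1 {I} {x} x∈I = gen (x , 1# , x∈I , 1∈^ᴵ0 I , sym (*-identityʳ x))

  ^ᴵ1⊆ : ∀ {I} → IsIdeal I → I ^ᴵ 1 ⊆ I
  ^ᴵ1⊆ idl = span-least idl λ (a , b , a∈I , _ , x≈ab) →
    resp∈ idl (trans (*-comm b a) (sym x≈ab)) (mul∈ idl b a∈I)

  ^-∈-^ᴵ : ∀ I d {x} → x ∈ I ^ᴵ d → ∀ n → x ^ n ∈ I ^ᴵ (n ℕ.* d)
  ^-∈-^ᴵ I d x∈ zero    = 1∈^ᴵ0 I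
  ^-∈-^ᴵ I d x∈ (suc n) = ^ᴵ-* I d (n ℕ.* d) x∈ (^-∈-^ᴵ I d x∈ n)

  ∈⇒^-∈-^ᴵ : ∀ {I x} → x ∈ I → ∀ n → x ^ n ∈ I ^ᴵ n
  ∈⇒^-∈-^ᴵ {I} {x} x∈I n =
    ≡.subst (λ k → x ^ n ∈ I ^ᴵ k) (ℕₚ.*-identityʳ n) (^-∈-^ᴵ I 1 (∈⇒∈^ᴵ1 x∈I) n)

  ^ᴵ-antitone : ∀ I {m n} → m ℕ.≤ n → I ^ᴵ n ⊆ I ^ᴵ m
  ^ᴵ-antitone I {n = n} ℕ.z≤n {x} x∈  = resp∈ (^ᴵ-isIdeal I 0) (*-identityʳ x) (mul∈ (^ᴵ-isIdeal I 0) x (1∈^ᴵ0 I))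
  ^ᴵ-antitone I (ℕ.s≤s m≤n) = span-least (span-isIdeal _) λ (a , b , a∈I , b∈ , x≈ab) →
    gen (a , b , a∈I , ^ᴵ-antitone I m≤n b∈ , x≈ab)

  1∈⇒∈ : {T : Pred Carrier t} → IsIdeal T → 1# ∈ T → ∀ {x} → x ∈ T
  1∈⇒∈ idl 1∈T {x} = resp∈ idl (*-identityʳ x) (mul∈ idl x 1∈T)

  -- (A + B) ^ (a + b) ⊆ A ^ a + B ^ b for A generated by the first generator and B by the others.
  ⟨⟩^ᴵ[a+b]⊆ : ∀ {n} (g : Vector Carrier (suc n)) a b {T : Pred Carrier t} → IsIdeal T →
               g Fin.zero ^ a ∈ T → ⟨ g ∘ Fin.suc ⟩ ^ᴵ b ⊆ T → ⟨ g ⟩ ^ᴵ (a ℕ.+ b) ⊆ T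
  ⟨⟩^ᴵ[a+b]⊆ g zero    b       idl g₀^a∈T gs^b⊆T _ = 1∈⇒∈ idl g₀^a∈T
  ⟨⟩^ᴵ[a+b]⊆ g (suc a) zero    idl g₀^a∈T gs^b⊆T _ = 1∈⇒∈ idl (gs^b⊆T (1∈^ᴵ0 ⟨ g ∘ Fin.suc ⟩))
  ⟨⟩^ᴵ[a+b]⊆ g (suc a) (suc b) {T} idl g₀^a∈T gs^b⊆T = span-least idl
    λ (x , y , x∈ , y∈ , z≈xy) → resp∈ idl (trans (*-comm y x) (sym z≈xy))
      (span-least (colon-isIdeal idl y)
        (λ (i , x≈) → resp∈ idl (trans (*-comm _ y) (*-congˡ (sym x≈))) (step y∈ i)) x∈)
    where
    -- Both cases recurse into the colon ideal `T : g i`: the first generator lowers the exponent a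
    -- still required of it, any other generator lowers b.
    step : ∀ {y} → y ∈ ⟨ g ⟩ ^ᴵ (a ℕ.+ suc b) → ∀ i → g i * y ∈ T
    step y∈ Fin.zero =
      ⟨⟩^ᴵ[a+b]⊆ g a (suc b) (colon-isIdeal idl _) g₀^a∈T (mul∈ idl _ ∘ gs^b⊆T) y∈
    step {y} y∈ (Fin.suc i) =
      ⟨⟩^ᴵ[a+b]⊆ g (suc a) b (colon-isIdeal idl (g (Fin.suc i))) (mul∈ idl _ g₀^a∈T)
        (λ w∈ → gs^b⊆T (gen (_ , _ , gen (i , refl) , w∈ , refl)))
        (≡.subst (λ k → y ∈ ⟨ g ⟩ ^ᴵ k) (ℕₚ.+-suc a b) y∈)

  -- In closed form `n * q + 1`. Without generators the value must be 1 and not 0, since the zeroth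
  -- power even of the zero ideal is the unit ideal.
  ⟨⟩^ᴵ-exponent : ℕ → ℕ → ℕ
  ⟨⟩^ᴵ-exponent q zero    = 1
  ⟨⟩^ᴵ-exponent q (suc n) = q ℕ.+ ⟨⟩^ᴵ-exponent q n

  -- Among so many factors some generator occurs at least q times; the induction splits off one
  -- generator at a time.
  ⟨⟩^ᴵ-pigeonhole : ∀ q {n} (g : Vector Carrier n) {T : Pred Carrier t} → IsIdeal T →
                    (∀ i → g i ^ q ∈ T) → ⟨ g ⟩ ^ᴵ ⟨⟩^ᴵ-exponent q n ⊆ T
  ⟨⟩^ᴵ-pigeonhole q {zero}  g idl g^q∈T x∈ =
    span-least idl (λ ()) (^ᴵ1⊆ (span-isIdeal _) x∈)
  ⟨⟩^ᴵ-pigeonhole q {suc n} g idl g^q∈T =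
    ⟨⟩^ᴵ[a+b]⊆ g q _ idl (g^q∈T Fin.zero) (⟨⟩^ᴵ-pigeonhole q (g ∘ Fin.suc) idl (g^q∈T ∘ Fin.suc))

  Radical : Pred Carrier t → Pred Carrier t
  Radical T x = ∃ λ n → x ^ n ∈ T

  -- For sums, a high power of `x + y` lies in a power of the ideal (x, y), and the pigeonhole
  -- principle puts the latter inside T; `m + n` is a common exponent for both generators.
  radical-isIdeal : {T : Pred Carrier t} → IsIdeal T → IsIdeal (Radical T)
  radical-isIdeal {T = T} idl = record
    { zero∈ = 1 , resp∈ idl (sym (*-identityʳ 0#)) (zero∈ idl)
    ; add∈  = λ {x} {y} → +-closed x y
    ; mul∈  = λ a {x} (n , xⁿ∈) → n , resp∈ idl (sym (^-distrib-* a x n)) (mul∈ idl (a ^ n) xⁿ∈)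
    ; resp∈ = λ eq (n , xⁿ∈) → n , resp∈ idl (^-congˡ n eq) xⁿ∈
    }
    where
    +-closed : ∀ x y → x ∈ Radical T → y ∈ Radical T → x + y ∈ Radical T
    +-closed x y (m , xᵐ∈) (n , yⁿ∈) = N ,
      ⟨⟩^ᴵ-pigeonhole (m ℕ.+ n) g idl g^∈ (∈⇒^-∈-^ᴵ (add (gen (Fin.zero , refl)) (gen (Fin.suc Fin.zero , refl))) N)
      where
      g = x ∷ y ∷ []
      N = ⟨⟩^ᴵ-exponent (m ℕ.+ n) 2
      g^∈ : ∀ i → g i ^ (m ℕ.+ n) ∈ T
      g^∈ Fin.zero           = resp∈ idl (trans (*-comm _ _) (sym (^-homo-* x m n))) (mul∈ idl (x ^ n) xᵐ∈)
      g^∈ (Fin.suc Fin.zero) = resp∈ idl (sym (^-homo-* y m n)) (mul∈ idl (y ^ m) yⁿ∈)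

  -- Congruences modulo ideals and p-th powers of sums

  infix 4 _≈_mod_
  _≈_mod_ : Carrier → Carrier → Pred Carrier t → Set (ℓ ⊔ t)
  x ≈ y mod T = ∃ λ u → u ∈ T × x ≈ y + u

  mod-euclidean : {T : Pred Carrier t} → IsIdeal T → ∀ {x y s} → x ≈ s mod T → y ≈ s mod T → x ≈ y mod T
  mod-euclidean idl {x} {y} {s} (u , u∈ , x≈) (v , v∈ , y≈) = u - v , add∈ idl u∈ (neg∈ idl v∈) , (begin
    x                  ≈⟨ x≈ ⟩
    s + u              ≈⟨ +-congˡ (//-rightDividesˡ v u) ⟨
    s + ((u - v) + v)  ≈⟨ solve 3 (λ s a v → s :+ (a :+ v) := s :+ v :+ a) refl s (u - v) v ⟩
    s + v + (u - v)    ≈⟨ +-congʳ y≈ ⟨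
    y + (u - v)        ∎)

  ·≈fromℕ* : ∀ n x → n · x ≈ fromℕ n * x
  ·≈fromℕ* n x = trans (×-congʳ n (sym (*-identityˡ x))) (sym (×-assoc-* n 1# x))

  -- In the binomial expansion every inner term has a coefficient divisible by p and is a product of
  -- p factors from `I ^ᴵ d`.
  [x+y]^p≈x^p+y^p : ∀ {p} → Prime p → ∀ I d {x y} → x ∈ I ^ᴵ d → y ∈ I ^ᴵ d →
                    (x + y) ^ p ≈ x ^ p + y ^ p mod fromℕ p ·ᴵ I ^ᴵ (p ℕ.* d)
  [x+y]^p≈x^p+y^p {zero}      pp I d x∈ y∈ = contradiction pp ¬prime[0]
  [x+y]^p≈x^p+y^p {p@(suc n)} pp I d {x} {y} x∈ y∈ = sum middle , middle∈ , (begin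
    (x + y) ^ p                                    ≈⟨ B.theorem p x y ⟩
    term Fin.zero + sum (term ∘ Fin.suc)           ≈⟨ +-congˡ (Sum.sum-init-last +-monoid (term ∘ Fin.suc)) ⟩
    term Fin.zero + (sum middle + term (Fin.fromℕ p))  ≈⟨ +-cong first (+-congˡ last) ⟩
    y ^ p + (sum middle + x ^ p)                   ≈⟨ solve 3 (λ a b c → a :+ (b :+ c) := c :+ a :+ b) refl _ _ _ ⟩
    x ^ p + y ^ p + sum middle                     ∎)
    where
    module B = Binomial (CommutativeRing.commutativeSemiring R)
    term = B.binomialTerm x y p
    idl = ^ᴵ-isIdeal I (p ℕ.* d)

    middle : Vector Carrier n
    middle i = term (Fin.suc (inject₁ i))

    first : term Fin.zero ≈ y ^ p
    first = trans (+-identityʳ _) (*-identityˡ _)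

    last : term (Fin.fromℕ p) ≈ x ^ p
    last = begin
      (p C toℕ (Fin.fromℕ p)) · (x ^ toℕ (Fin.fromℕ p) * y ^ (p ℕ.∸ toℕ (Fin.fromℕ p)))
        ≡⟨ ≡.cong (λ k → (p C k) · (x ^ k * y ^ (p ℕ.∸ k))) (Finₚ.toℕ-fromℕ p) ⟩
      (p C p) · (x ^ p * y ^ (p ℕ.∸ p))
        ≡⟨ ≡.cong₂ (λ c k → c · (x ^ p * y ^ k)) (nCn≡1 p) (ℕₚ.n∸n≡0 p) ⟩
      1 · (x ^ p * 1#)
        ≈⟨ trans (+-identityʳ _) (*-identityʳ _) ⟩
      x ^ p ∎

    term∈ : ∀ k → 0 ℕ.< k → k ℕ.< p → (p C k) · (x ^ k * y ^ (p ℕ.∸ k)) ∈ fromℕ p ·ᴵ I ^ᴵ (p ℕ.* d)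
    term∈ k 0<k k<p with prime∣C pp k 0<k k<p
    ... | divides c pCk≡c*p = c · xᵏyˡ , resp∈ idl (sym (·≈fromℕ* c xᵏyˡ)) (mul∈ idl (fromℕ c) xᵏyˡ∈) , (begin
      (p C k) · xᵏyˡ                ≡⟨ ≡.cong (_· xᵏyˡ) (≡.trans pCk≡c*p (ℕₚ.*-comm c p)) ⟩
      (p ℕ.* c) · xᵏyˡ              ≈⟨ ×-assocˡ xᵏyˡ p c ⟨
      p · (c · xᵏyˡ)                ≈⟨ ·≈fromℕ* p _ ⟩
      fromℕ p * (c · xᵏyˡ)          ∎)
      where
      xᵏyˡ = x ^ k * y ^ (p ℕ.∸ k)
      xᵏyˡ∈ : xᵏyˡ ∈ I ^ᴵ (p ℕ.* d)
      xᵏyˡ∈ = ≡.subst (λ e → xᵏyˡ ∈ I ^ᴵ e)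
        (≡.trans (≡.sym (ℕₚ.*-distribʳ-+ d k (p ℕ.∸ k))) (≡.cong (ℕ._* d) (ℕₚ.m+[n∸m]≡n (ℕₚ.<⇒≤ k<p))))
        (^ᴵ-* I (k ℕ.* d) ((p ℕ.∸ k) ℕ.* d) (^-∈-^ᴵ I d x∈ k) (^-∈-^ᴵ I d y∈ (p ℕ.∸ k)))

    middle∈ : sum middle ∈ fromℕ p ·ᴵ I ^ᴵ (p ℕ.* d)
    middle∈ = sum∈ (·ᴵ-isIdeal _ idl) middle λ i → term∈ (suc (toℕ (inject₁ i))) (ℕ.s≤s ℕ.z≤n)
      (ℕ.s≤s (≡.subst (ℕ._< n) (≡.sym (Finₚ.toℕ-inject₁ i)) (Finₚ.toℕ<n i)))

  -- The error `πu` is treated as one more summand next to `x + y`. In its own p-th power, one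
  -- factor p is kept in front, and u together with the other `p - 1` factors `πu` lies in
  -- `I ^ᴵ (p * d)`.
  ≈x+y⇒^p≈x^p+y^p : ∀ {p} → Prime p → ∀ I d {x y z} → x ∈ I ^ᴵ d → y ∈ I ^ᴵ d →
                    z ≈ x + y mod fromℕ p ·ᴵ I ^ᴵ d →
                    z ^ p ≈ x ^ p + y ^ p mod fromℕ p ·ᴵ I ^ᴵ (p ℕ.* d)
  ≈x+y⇒^p≈x^p+y^p {zero}      pp = contradiction pp ¬prime[0]
  ≈x+y⇒^p≈x^p+y^p {p@(suc n)} pp I d {x} {y} {z} x∈ y∈ (v , (u , u∈ , v≈) , z≈) =
    let (a , a∈ , eqa) = [x+y]^p≈x^p+y^p pp I d x∈ y∈
        (b , b∈ , eqb) = [x+y]^p≈x^p+y^p pp I d (add∈ (^ᴵ-isIdeal I d) x∈ y∈) πu∈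
    in a + (πu ^ p + b) , add∈ idl a∈ (add∈ idl πu^p∈ b∈) , (begin
      z ^ p                              ≈⟨ ^-congˡ p (trans z≈ (+-congˡ v≈)) ⟩
      (x + y + πu) ^ p                   ≈⟨ eqb ⟩
      (x + y) ^ p + πu ^ p + b           ≈⟨ +-congʳ (+-congʳ eqa) ⟩
      x ^ p + y ^ p + a + πu ^ p + b     ≈⟨ trans (+-assoc _ _ _) (+-assoc _ _ _) ⟩
      x ^ p + y ^ p + (a + (πu ^ p + b)) ∎)
    where
    πu = fromℕ p * u
    idl = ·ᴵ-isIdeal (fromℕ p) (^ᴵ-isIdeal I (p ℕ.* d))
    πu∈ : πu ∈ I ^ᴵ d
    πu∈ = mul∈ (^ᴵ-isIdeal I d) (fromℕ p) u∈
    πu^p∈ : πu ^ p ∈ fromℕ p ·ᴵ I ^ᴵ (p ℕ.* d)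
    πu^p∈ = u * πu ^ n , ^ᴵ-* I d (n ℕ.* d) u∈ (^-∈-^ᴵ I d πu∈ n) , *-assoc _ _ _

  -- Iteration of the p-th power, at each stage with `d = p ^ e`: the power of I in the error then
  -- grows along with the exponent.
  [x+y]^pᵉ≈x^pᵉ+y^pᵉ : ∀ {p} → Prime p → ∀ I {x y} → x ∈ I → y ∈ I → ∀ e →
    (x + y) ^ (p ℕ.^ e) ≈ x ^ (p ℕ.^ e) + y ^ (p ℕ.^ e) mod fromℕ p ·ᴵ I ^ᴵ (p ℕ.^ e)
  [x+y]^pᵉ≈x^pᵉ+y^pᵉ {p} pp I {x} {y} x∈ y∈ zero    =
    0# , zero∈ (·ᴵ-isIdeal (fromℕ p) (^ᴵ-isIdeal I 1)) ,
    solve 2 (λ x y → (x :+ y) :* con 1 := x :* con 1 :+ y :* con 1 :+ con 0) refl x y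
  [x+y]^pᵉ≈x^pᵉ+y^pᵉ {p} pp I {x} {y} x∈ y∈ (suc e) =
    let (u , u∈ , eq) = ≈x+y⇒^p≈x^p+y^p pp I q (∈⇒^-∈-^ᴵ x∈ q) (∈⇒^-∈-^ᴵ y∈ q)
                          ([x+y]^pᵉ≈x^pᵉ+y^pᵉ pp I x∈ y∈ e)
    in u , u∈ , trans (^-* (x + y)) (trans eq (+-congʳ (sym (+-cong (^-* x) (^-* y)))))
    where
    q = p ℕ.^ e
    ^-* : ∀ z → z ^ (p ℕ.* q) ≈ (z ^ q) ^ p
    ^-* z = trans (^-congʳ z (ℕₚ.*-comm p q)) (sym (^-assocʳ z q p))

-- Witt vectors

n<p^n : ∀ {p} → Prime p → ∀ n → n ℕ.< p ℕ.^ n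
n<p^n     pp zero    = ℕ.s≤s ℕ.z≤n
n<p^n {p} pp (suc n) = begin
  suc (suc n)         ≤⟨ ℕₚ.m≤n+m (suc (suc n)) n ⟩
  n ℕ.+ suc (suc n)   ≡⟨ ℕₚ.+-suc n (suc n) ⟩
  suc n ℕ.+ suc n     ≡⟨ ≡.cong (suc n ℕ.+_) (ℕₚ.+-identityʳ (suc n)) ⟨
  2 ℕ.* suc n         ≤⟨ ℕₚ.*-mono-≤ (ℕ.nonTrivial⇒n>1 p {{prime⇒nonTrivial pp}}) (n<p^n pp n) ⟩
  p ℕ.* p ℕ.^ n       ∎
  where open ℕₚ.≤-Reasoning

module Teichmüller
  {p : ℕ} (pp : Prime p) (S : CommutativeRing ℓ ℓ) (𝕎 : WittVectors p S)
  {m : ℕ} (x : Vector (CommutativeRing.Carrier S) m) where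

  private
    open WittVectors 𝕎 hiding (commutativeRing)
    module S = Ring S
    module W = Ring (WittVectors.commutativeRing 𝕎)
    module SI = Ideals S
    module WI = Ideals (WittVectors.commutativeRing 𝕎)
    module S^ = Exp (CommutativeRing.commutativeSemiring S)
    module W^ = Exp (CommutativeRing.commutativeSemiring (WittVectors.commutativeRing 𝕎))
    module H = RingMorphisms.IsRingHomomorphism reduce-isHomomorphism
    module WP = RingProperties (CommutativeRing.ring (WittVectors.commutativeRing 𝕎))
    open WI.IsIdeal
    open SetoidReasoning W.setoid
    open SemiringSolver (CommutativeRing.commutativeSemiring (WittVectors.commutativeRing 𝕎))
      using (solve; con; _:+_; _:*_; _:=_)

    π : W.Carrier
    π = W.fromℕ p

  I : Pred S.Carrier _
  I = S.⟨ x ⟩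

  J : Pred W.Carrier _
  J = W.⟨ π ∷ ([_] ∘ x) ⟩

  J-isIdeal : WI.IsIdeal J
  J-isIdeal = WI.span-isIdeal _

  J^-isIdeal : ∀ n → WI.IsIdeal (J W.^ᴵ n)
  J^-isIdeal = WI.^ᴵ-isIdeal J

  π∈J : π ∈ J
  π∈J = W.gen (Fin.zero , W.refl)

  πt∈J : ∀ t → π W.* t ∈ J
  πt∈J t = W.resp (W.*-comm t π) (W.mul t π∈J)

  reduce-π* : ∀ t → reduce (π W.* t) S.≈ S.0#
  reduce-π* t = Equivalence.from (reduce-kernel (π W.* t)) (t , W.refl)

  []-^ : ∀ a n → [ a S.^ n ] W.≈ [ a ] W.^ n
  []-^ a zero    = []-1-homo
  []-^ a (suc n) = W.trans ([]-*-homo a (a S.^ n)) (W.*-congˡ ([]-^ a n))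

  reduce≈⇒≈+π* : ∀ v w → reduce v S.≈ reduce w → ∃ λ t → v W.≈ w W.+ π W.* t
  reduce≈⇒≈+π* v w eq =
    let (t , v-w≈πt) = Equivalence.to (reduce-kernel (v W.- w)) reduce[v-w]≈0
    in t , W.trans (W.sym (WP.//-rightDividesˡ w v))
             (W.trans (W.+-congʳ v-w≈πt) (W.+-comm (π W.* t) w))
    where
    reduce[v-w]≈0 : reduce (v W.- w) S.≈ S.0#
    reduce[v-w]≈0 = S.trans (H.+-homo v (W.- w)) (S.trans (S.+-cong eq (H.-‿homo w)) (S.-‿inverseʳ _))

  ≈[]+π* : ∀ v a → reduce v S.≈ a → ∃ λ t → v W.≈ [ a ] W.+ π W.* t
  ≈[]+π* v a eq = reduce≈⇒≈+π* v [ a ] (S.trans eq (S.sym (reduce-[] a)))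

  preimage-isIdeal : {T : Pred S.Carrier t} → SI.IsIdeal T → WI.IsIdeal (T ∘ reduce)
  preimage-isIdeal idl = record
    { zero∈ = resp∈′ (S.sym H.0#-homo) zero∈′
    ; add∈  = λ a b → resp∈′ (S.sym (H.+-homo _ _)) (add∈′ a b)
    ; mul∈  = λ c a → resp∈′ (S.sym (H.*-homo _ _)) (mul∈′ (reduce c) a)
    ; resp∈ = λ eq → resp∈′ (H.⟦⟧-cong eq)
    }
    where open SI.IsIdeal idl renaming (zero∈ to zero∈′; add∈ to add∈′; mul∈ to mul∈′; resp∈ to resp∈′)

  reduce∈I : ∀ {v} → v ∈ J → reduce v ∈ I
  reduce∈I = WI.span-least (preimage-isIdeal (SI.span-isIdeal _)) λ
    { (Fin.zero  , v≈π)   → S.resp (S.sym (S.trans (H.⟦⟧-cong (W.trans v≈π (W.sym (W.*-identityʳ π)))) (reduce-π* W.1#))) S.zero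
    ; (Fin.suc i , v≈[x]) → S.gen (i , S.trans (H.⟦⟧-cong v≈[x]) (reduce-[] (x i)))
    }

  reduce∈I^ : ∀ n {v} → v ∈ J W.^ᴵ n → reduce v ∈ I S.^ᴵ n
  reduce∈I^ zero    = WI.span-least (preimage-isIdeal (SI.^ᴵ-isIdeal I 0)) λ 1≈v →
    S.gen (S.trans (S.sym H.1#-homo) (H.⟦⟧-cong 1≈v))
  reduce∈I^ (suc n) = WI.span-least (preimage-isIdeal (SI.^ᴵ-isIdeal I (suc n))) λ (a , b , a∈ , b∈ , v≈ab) →
    S.gen (reduce a , reduce b , reduce∈I a∈ , reduce∈I^ n b∈ , S.trans (H.⟦⟧-cong v≈ab) (H.*-homo a b))

  -- Quantifying over all lifts v of a makes this property of a closed under addition: `[_]` need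
  -- not be additive, but two lifts of the same element differ by a multiple of `π`, which lies in
  -- J.
  reduce∈I⇒∈J : ∀ {a} → a ∈ I → ∀ v → reduce v S.≈ a → v ∈ J
  reduce∈I⇒∈J = SI.span-least
    (record
      { zero∈ = λ v v↦0 → let (t , v≈πt) = Equivalence.to (reduce-kernel v) v↦0
                          in W.resp (W.sym v≈πt) (πt∈J t)
      ; add∈  = λ {a} {b} a∈ b∈ v v↦a+b →
          let (t , v≈) = reduce≈⇒≈+π* v ([ a ] W.+ [ b ]) (S.trans v↦a+b (S.sym
                (S.trans (H.+-homo _ _) (S.+-cong (reduce-[] a) (reduce-[] b)))))
          in W.resp (W.sym v≈) (W.add (W.add (a∈ [ a ] (reduce-[] a)) (b∈ [ b ] (reduce-[] b))) (πt∈J t))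
      ; mul∈  = λ c {a} a∈ v v↦ca →
          let (t , v≈) = ≈[]+π* v (c S.* a) v↦ca
          in W.resp (W.sym (W.trans v≈ (W.+-congʳ ([]-*-homo c a))))
               (W.add (W.mul [ c ] (a∈ [ a ] (reduce-[] a))) (πt∈J t))
      ; resp∈ = λ a≈b a∈ v v↦b → a∈ v (S.trans v↦b (S.sym a≈b))
      })
    λ (i , a≈x) v v↦a → let (t , v≈) = ≈[]+π* v (x i) (S.trans v↦a a≈x)
                        in W.resp (W.sym v≈) (W.add (W.gen (Fin.suc i , W.refl)) (πt∈J t))

  []∈J : ∀ {a} → a ∈ I → [ a ] ∈ J
  []∈J a∈I = reduce∈I⇒∈J a∈I [ _ ] (reduce-[] _)

  [^]∈J^ : ∀ {a} → a ∈ I → ∀ {n k} → n ℕ.≤ k → [ a S.^ k ] ∈ J W.^ᴵ n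
  [^]∈J^ {a} a∈I {n} {k} n≤k = WI.^ᴵ-antitone J n≤k
    (resp∈ (J^-isIdeal k) (W.sym ([]-^ a k)) (WI.∈⇒^-∈-^ᴵ ([]∈J a∈I) k))

  -- The remainder after n digits is a multiple of `π ^ n` and so lies in the n-th power of J
  -- anyway.
  [digits]∈J^⇒∈J^ : ∀ n z → (∀ k → k ℕ.< n → [ digit z k ] ∈ J W.^ᴵ n) → z ∈ J W.^ᴵ n
  [digits]∈J^⇒∈J^ n z [digit]∈ = resp∈ idl z≈
    (add∈ idl (partialSum∈ n ℕₚ.≤-refl) (resp∈ idl (W.*-comm _ _) (mul∈ idl (tail z n) (WI.∈⇒^-∈-^ᴵ π∈J n))))
    where
    idl = J^-isIdeal n
    partialSum∈ : ∀ k → k ℕ.≤ n → partialSum (digit z) k ∈ J W.^ᴵ n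
    partialSum∈ zero    _   = zero∈ idl
    partialSum∈ (suc k) k<n = add∈ idl (partialSum∈ k (ℕₚ.<⇒≤ k<n)) (mul∈ idl (π W.^ k) ([digit]∈ k k<n))
    z≈ : partialSum (digit z) n W.+ π W.^ n W.* tail z n W.≈ z
    z≈ = begin
      partialSum (digit z) n W.+ π W.^ n W.* tail z n           ≈⟨ W.+-congˡ (digit-expansion z n) ⟨
      partialSum (digit z) n W.+ (z W.- partialSum (digit z) n) ≈⟨ W.+-comm _ _ ⟩
      (z W.- partialSum (digit z) n) W.+ partialSum (digit z) n ≈⟨ WP.//-rightDividesˡ _ z ⟩
      z                                                         ∎

  ≈[digit]+π*shift : ∀ z → z W.≈ [ reduce z ] W.+ π W.* shift z
  ≈[digit]+π*shift z = begin
    z                                                         ≈⟨ WP.//-rightDividesˡ _ z ⟨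
    (z W.- partialSum (digit z) 1) W.+ partialSum (digit z) 1 ≈⟨ W.+-congʳ (digit-expansion z 1) ⟩
    π W.* W.1# W.* shift z W.+ (W.0# W.+ W.1# W.* [ reduce z ])
      ≈⟨ solve 3 (λ π s r → π :* con 1 :* s :+ (con 0 :+ con 1 :* r) := r :+ π :* s) W.refl π (shift z) [ reduce z ] ⟩
    [ reduce z ] W.+ π W.* shift z                            ∎

  π*-cancel : ∀ a b → π W.* a W.≈ π W.* b → a W.≈ b
  π*-cancel a b πa≈πb = WP.x∙y⁻¹≈ε⇒x≈y a b (p-torsionFree (a W.- b)
    (W.trans (WP.x[y-z]≈xy-xz π a b) (W.trans (W.+-congʳ πa≈πb) (W.-‿inverseʳ _))))

  -- Continuity of the shift at 0 in the J-adic topology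

  module ShiftBound
    (q-1 : ℕ)
    (additive : ∀ {a b} → a ∈ J → b ∈ J →
       (a W.+ b) W.^ suc q-1 WI.≈ a W.^ suc q-1 W.+ b W.^ suc q-1 mod π WI.·ᴵ J W.^ᴵ suc q-1)
    (root : ∀ a → ∃ λ b → b S.^ suc q-1 S.≈ a) where

    private
      q = suc q-1

    T : Pred W.Carrier _
    T = π WI.·ᴵ J W.^ᴵ q-1

    T-isIdeal : WI.IsIdeal T
    T-isIdeal = WI.·ᴵ-isIdeal π (J^-isIdeal q-1)

    -- One of the q factors is spent on the explicit multiple of `π`, and its cofactor t need not
    -- lie in J. The remaining `q-1` factors do, whence the exponent in the definition of T.
    π∣⇒^q∈T : ∀ {a} t → a W.≈ π W.* t → a W.^ q ∈ T
    π∣⇒^q∈T {a} t a≈πt = t W.* a W.^ q-1 ,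
      mul∈ (J^-isIdeal q-1) t (WI.∈⇒^-∈-^ᴵ (resp∈ J-isIdeal (W.sym a≈πt) (πt∈J t)) q-1) ,
      W.trans (W.*-congʳ a≈πt) (W.*-assoc π t _)

    -- The lift `[ α S.+ β ]` equals `[ α ] + [ β ] + π * t` for some t. Additivity of the q-th
    -- power is used twice, and the q-th power of `π * t` is absorbed by T.
    [+]^q : ∀ {α β} → α ∈ I → β ∈ I → [ α S.+ β ] W.^ q WI.≈ [ α ] W.^ q W.+ [ β ] W.^ q mod T
    [+]^q {α} {β} α∈ β∈ =
      let (t , [α+β]≈)   = reduce≈⇒≈+π* [ α S.+ β ] ([ α ] W.+ [ β ]) (S.trans (reduce-[] (α S.+ β))
                             (S.sym (S.trans (H.+-homo _ _) (S.+-cong (reduce-[] α) (reduce-[] β)))))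
          (u , u∈ , eq₁) = additive ([]∈J α∈) ([]∈J β∈)
          (v , v∈ , eq₂) = additive (W.add ([]∈J α∈) ([]∈J β∈)) (πt∈J t)
          πt^q           = (π W.* t) W.^ q
      in u W.+ (πt^q W.+ v) , add∈ T-isIdeal (weaken u∈) (add∈ T-isIdeal (π∣⇒^q∈T t W.refl) (weaken v∈)) , (begin
        [ α S.+ β ] W.^ q                                        ≈⟨ W^.^-congˡ q [α+β]≈ ⟩
        ([ α ] W.+ [ β ] W.+ π W.* t) W.^ q                      ≈⟨ eq₂ ⟩
        ([ α ] W.+ [ β ]) W.^ q W.+ πt^q W.+ v                   ≈⟨ W.+-congʳ (W.+-congʳ eq₁) ⟩
        [ α ] W.^ q W.+ [ β ] W.^ q W.+ u W.+ πt^q W.+ v         ≈⟨ W.trans (W.+-assoc _ _ _) (W.+-assoc _ _ _) ⟩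
        [ α ] W.^ q W.+ [ β ] W.^ q W.+ (u W.+ (πt^q W.+ v))     ∎)
      where
      weaken : π WI.·ᴵ J W.^ᴵ q ⊆ T
      weaken (u , u∈ , eq) = u , WI.^ᴵ-antitone J (ℕₚ.n≤1+n q-1) u∈ , eq

    G : Pred W.Carrier _
    G a = ∃ λ α → α ∈ I × a WI.≈ [ α ] W.^ q mod T

    T⊆G : T ⊆ G
    T⊆G {a} a∈T = S.0# , S.zero , WI.mod-euclidean T-isIdeal
      (a , a∈T , W.sym (W.+-identityˡ a))
      ([ S.0# ] W.^ q , [0]^q∈T , W.sym (W.+-identityˡ _))
      where
      [0]^q∈T : [ S.0# ] W.^ q ∈ T
      -- It is enough that `[ S.0# ]` reduces to 0 and is therefore a multiple of `π`.
      [0]^q∈T = let (t , [0]≈πt) = Equivalence.to (reduce-kernel [ S.0# ]) (reduce-[] S.0#) in π∣⇒^q∈T t [0]≈πt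

    G-isIdeal : WI.IsIdeal G
    G-isIdeal = record
      { zero∈ = T⊆G (zero∈ T-isIdeal)
      ; add∈  = λ {a} {b} (α , α∈ , u , u∈ , a≈) (β , β∈ , v , v∈ , b≈) →
          α S.+ β , S.add α∈ β∈ , WI.mod-euclidean T-isIdeal
            (u W.+ v , add∈ T-isIdeal u∈ v∈ , W.trans (W.+-cong a≈ b≈)
              (solve 4 (λ α u β v → (α :+ u) :+ (β :+ v) := (α :+ β) :+ (u :+ v)) W.refl _ u _ v))
            ([+]^q α∈ β∈)
      ; mul∈  = λ c {a} (α , α∈ , u , u∈ , a≈) →
          -- The existence of roots in S makes any coefficient c congruent to `[ γ ] ^ q` modulo
          -- `π`, so that `γ * α` represents `c * a`.
          let (γ , γ^q≈) = root (reduce c)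
              (t , c≈)   = ≈[]+π* c (γ S.^ q) (S.sym γ^q≈)
          in γ S.* α , S.mul γ α∈ , π W.* (t W.* [ α ] W.^ q) W.+ c W.* u ,
             add∈ T-isIdeal
               (t W.* [ α ] W.^ q , mul∈ (J^-isIdeal q-1) t (WI.^ᴵ-antitone J (ℕₚ.n≤1+n q-1) (WI.∈⇒^-∈-^ᴵ ([]∈J α∈) q)) , W.refl)
               (mul∈ T-isIdeal c u∈) ,
             (begin
               c W.* a                                                  ≈⟨ W.*-congˡ a≈ ⟩
               c W.* ([ α ] W.^ q W.+ u)                                ≈⟨ W.distribˡ c _ u ⟩
               c W.* [ α ] W.^ q W.+ c W.* u                            ≈⟨ W.+-congʳ (W.*-congʳ (W.trans c≈ (W.+-congʳ ([]-^ γ q)))) ⟩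
               ([ γ ] W.^ q W.+ π W.* t) W.* [ α ] W.^ q W.+ c W.* u
                 ≈⟨ solve 5 (λ γ π t α cu → (γ :+ π :* t) :* α :+ cu := γ :* α :+ (π :* (t :* α) :+ cu)) W.refl _ π t _ _ ⟩
               [ γ ] W.^ q W.* [ α ] W.^ q W.+ (π W.* (t W.* [ α ] W.^ q) W.+ c W.* u)
                 ≈⟨ W.+-congʳ (W.trans (W^.^-congˡ q ([]-*-homo γ α)) (W^.^-distrib-* [ γ ] [ α ] q)) ⟨
               [ γ S.* α ] W.^ q W.+ (π W.* (t W.* [ α ] W.^ q) W.+ c W.* u) ∎)
      ; resp∈ = λ a≈b (α , α∈ , u , u∈ , a≈) → α , α∈ , u , u∈ , W.trans (W.sym a≈b) a≈
      }

    generators^q∈G : ∀ i → (π ∷ ([_] ∘ x)) i W.^ q ∈ G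
    generators^q∈G Fin.zero    = T⊆G (π∣⇒^q∈T W.1# (W.sym (W.*-identityʳ π)))
    generators^q∈G (Fin.suc i) =
      x i , S.gen (i , S.refl) , W.0# , zero∈ T-isIdeal , W.sym (W.+-identityʳ _)

    J^⊆G : J W.^ᴵ WI.⟨⟩^ᴵ-exponent q (suc m) ⊆ G
    J^⊆G = WI.⟨⟩^ᴵ-pigeonhole q (π ∷ ([_] ∘ x)) G-isIdeal generators^q∈G

    G⇒shift∈J^ : ∀ {z} → z ∈ G → shift z ∈ J W.^ᴵ q-1
    G⇒shift∈J^ {z} (α , α∈ , v , (u , u∈ , v≈πu) , z≈) =
      resp∈ (J^-isIdeal q-1) (W.sym (π*-cancel (shift z) u π*shift≈πu)) u∈
      where
      z≈[α]^q+πu : z W.≈ [ α ] W.^ q W.+ π W.* u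
      z≈[α]^q+πu = W.trans z≈ (W.+-congˡ v≈πu)

      reduce-z : reduce z S.≈ α S.^ q
      reduce-z = S.trans (H.⟦⟧-cong (W.trans z≈[α]^q+πu (W.+-congʳ (W.sym ([]-^ α q)))))
        (S.trans (H.+-homo _ _) (S.trans (S.+-cong (reduce-[] _) (reduce-π* u)) (S.+-identityʳ _)))

      π*shift≈πu : π W.* shift z W.≈ π W.* u
      π*shift≈πu = WP.+-cancelˡ ([ α ] W.^ q) _ _ (begin
        [ α ] W.^ q W.+ π W.* shift z   ≈⟨ W.+-congʳ (W.trans ([]-cong reduce-z) ([]-^ α q)) ⟨
        [ reduce z ] W.+ π W.* shift z  ≈⟨ ≈[digit]+π*shift z ⟨
        z                               ≈⟨ z≈[α]^q+πu ⟩
        [ α ] W.^ q W.+ π W.* u         ∎)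

  module _ (root : ∀ a → ∃ λ b → b S.^ p S.≈ a) where

    root^ : ∀ e a → ∃ λ b → b S.^ (p ℕ.^ e) S.≈ a
    root^ zero    a = a , S.*-identityʳ a
    root^ (suc e) a =
      let (b , b^q≈a) = root^ e a
          (c , c^p≈b) = root b
      in c , S.trans (S.sym (S^.^-assocʳ c p (p ℕ.^ e))) (S.trans (S^.^-congˡ (p ℕ.^ e) c^p≈b) b^q≈a)

    shift∈J^ : ∀ n → ∃ λ N → ∀ {z} → z ∈ J W.^ᴵ N → shift z ∈ J W.^ᴵ n
    shift∈J^ n = bound (n<p^n pp n) (λ a∈ b∈ → WI.[x+y]^pᵉ≈x^pᵉ+y^pᵉ pp J a∈ b∈ n) (root^ n)
      where
      -- With `p ^ n` abstracted to a variable q, matching on `n < q` exposes q as a successor and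
      -- yields `n ≤ q-1`.
      bound : ∀ {q} → n ℕ.< q →
        (∀ {a b} → a ∈ J → b ∈ J → (a W.+ b) W.^ q WI.≈ a W.^ q W.+ b W.^ q mod π WI.·ᴵ J W.^ᴵ q) →
        (∀ a → ∃ λ b → b S.^ q S.≈ a) → ∃ λ N → ∀ {z} → z ∈ J W.^ᴵ N → shift z ∈ J W.^ᴵ n
      bound (ℕ.s≤s {n = q-1} n≤q-1) additive root′ =
        WI.⟨⟩^ᴵ-exponent (suc q-1) (suc m) , λ z∈ → WI.^ᴵ-antitone J n≤q-1 (G⇒shift∈J^ (J^⊆G z∈))
        where open ShiftBound q-1 additive root′

    tail∈J^ : ∀ k n → ∃ λ N → ∀ {z} → z ∈ J W.^ᴵ N → ∀ j → j ℕ.≤ k → tail z j ∈ J W.^ᴵ n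
    tail∈J^ zero    n = n , λ { z∈ zero _ → z∈ }
    tail∈J^ (suc k) n with shift∈J^ n
    -- The maximum serves two purposes: exponent n for the tails up to index k, and exponent N₁ for
    -- the k-th tail, which is shifted once more.
    ... | N₁ , shift∈ with tail∈J^ k (n ℕ.⊔ N₁)
    ... | N₂ , tail∈ = N₂ , bound
      where
      bound : ∀ {z} → z ∈ J W.^ᴵ N₂ → ∀ j → j ℕ.≤ suc k → tail z j ∈ J W.^ᴵ n
      bound z∈ j j≤1+k with ℕₚ.m≤n⇒m<n∨m≡n j≤1+k
      ... | inj₁ j<1+k  = WI.^ᴵ-antitone J (ℕₚ.m≤m⊔n n N₁) (tail∈ z∈ j (ℕₚ.≤-pred j<1+k))
      ... | inj₂ ≡.refl = shift∈ (WI.^ᴵ-antitone J (ℕₚ.m≤n⊔m n N₁) (tail∈ z∈ k ℕₚ.≤-refl))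

    digit∈I^ : ∀ k n → ∃ λ N → ∀ {z} → z ∈ J W.^ᴵ N → ∀ j → j ℕ.≤ k → digit z j ∈ I S.^ᴵ n
    digit∈I^ k n = let (N , tail∈) = tail∈J^ k n in N , λ z∈ j j≤k → reduce∈I^ n (tail∈ z∈ j j≤k)

-- The topology of R⁺

module SubringRoots
  (R : TopologicalRing ℓ) (R⁺ : Subring (TopologicalRing.commutativeRing R)) where

  open TopologicalRing R
  open Subring R⁺ using (Member)
  private
    module S = Ring (Subring.asRing R⁺)

  proj₁-^ : ∀ (a : S.Carrier) n → proj₁ (a S.^ n) ≡ proj₁ a ^ n
  proj₁-^ a zero    = ≡.refl
  proj₁-^ a (suc n) = ≡.cong (proj₁ a *_) (proj₁-^ a n)

  -- The element b is a zero of the monic polynomial `T ^ suc n - a`, whose only nonleading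
  -- coefficient that may be nonzero is the constant term.
  rootClosed : IsIntegrallyClosed R R⁺ → ∀ n {a b} → a ∈ Member → b ^ suc n ≈ a → b ∈ Member
  rootClosed closed n {a} {b} a∈ bⁿ≈a = closed (suc n) coeff coeff∈ b (begin
    b ^ suc n + (- a * 1# + sum {n} (λ i → 0# * b ^ toℕ (Fin.suc i)))
      ≈⟨ +-cong bⁿ≈a (+-cong (*-identityʳ _) (trans
           (Sum.sum-cong-≋ +-monoid {n} (λ i → zeroˡ (b ^ toℕ (Fin.suc i)))) (Sum.sum-replicate-zero +-monoid n))) ⟩
    a + (- a + 0#)
      ≈⟨ trans (+-congˡ (+-identityʳ _)) (-‿inverseʳ a) ⟩
    0# ∎)
    where
    open SetoidReasoning setoid
    coeff : Vector Carrier (suc n)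
    coeff = - a ∷ replicate n 0#
    coeff∈ : ∀ i → coeff i ∈ Member
    coeff∈ Fin.zero    = Subring.-‿closed R⁺ a∈
    coeff∈ (Fin.suc i) = Subring.0-closed R⁺

  perfect⇒root : ∀ {p} → Prime p → IsIntegrallyClosed R R⁺ → Perfect p → ∀ a → ∃ λ b → b S.^ p S.≈ a
  perfect⇒root {zero}  pp closed perfect (a , a∈) = contradiction pp ¬prime[0]
  perfect⇒root {suc n} pp closed perfect (a , a∈) =
    let (b , bᵖ≈a) = proj₂ perfect a
        b⁺ = b , rootClosed closed n a∈ bᵖ≈a
    in b⁺ , trans (reflexive (proj₁-^ b⁺ (suc n))) bᵖ≈a

module NormedRing
  (R : TopologicalRing ℓ) (∥_∥ : TopologicalRing.Carrier R → ℝ∞)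
  (isNorm : TopologicalRing.IsNorm R ∥_∥)
  (open⇔normOpen : TopologicalRing.Open R ≋ TopologicalRing.NormOpen R ∥_∥) where

  open TopologicalRing R
  private
    module N = IsNorm isNorm
    open RingProperties ring using (-0#≈0#; -‿involutive; //-rightDividesˡ)
    open Ideals commutativeRing
    open IsIdeal
    open SemiringSolver (CommutativeRing.commutativeSemiring commutativeRing)
      using (solve; _:*_; _:=_)

  above-cong : ∀ {a b q} → a ≈ b → Above ∥ a ∥ q → Above ∥ b ∥ q
  above-cong {q = q} a≈b = proj₂ (N.cong a≈b) q

  above-0 : ∀ {q} → 0ℚ ℚ.< q → Above ∥ 0# ∥ q
  above-0 {q} = proj₁ N.∥0∥≈0 q

  above-neg : ∀ {a q} → Above ∥ a ∥ q → Above ∥ - a ∥ q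
  above-neg {a} {q} a<q = above-cong (+-identityˡ (- a))
    (N.nonarchimedean 0# a q (above-0 (ℝ∞.positive ∥ a ∥ a<q) , a<q))

  above-+ : ∀ {a b q} → Above ∥ a ∥ q → Above ∥ b ∥ q → Above ∥ a + b ∥ q
  above-+ {a} {b} {q} a<q b<q = above-cong (+-congˡ (-‿involutive b))
    (N.nonarchimedean a (- b) q (a<q , above-neg b<q))

  x-0≈x : ∀ x → x - 0# ≈ x
  x-0≈x x = trans (+-congˡ -0#≈0#) (+-identityʳ x)

  Ball : ℚ → Pred Carrier ℓ
  Ball δ y = Lift ℓ (Above ∥ y ∥ δ)

  -- By the ultrametric inequality a ball contains a ball of the same radius around each of its
  -- points.
  ball-open : ∀ {δ} → 0ℚ ℚ.< δ → Open (Ball δ)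
  ball-open {δ} 0<δ = Equivalence.from (open⇔normOpen (Ball δ)) λ x (lift x<δ) →
    δ , 0<δ , λ y y-x<δ → lift (above-cong (//-rightDividesˡ x y) (above-+ y-x<δ x<δ))

  open⇒⊇ball : ∀ {V} → Open V → 0# ∈ V → ∃ λ ε → 0ℚ ℚ.< ε × (∀ y → Above ∥ y ∥ ε → y ∈ V)
  open⇒⊇ball {V} V-open 0∈V =
    let (ε , 0<ε , ball⊆V) = Equivalence.to (open⇔normOpen V) V-open 0# 0∈V
    in ε , 0<ε , λ y y<ε → ball⊆V y (above-cong (sym (x-0≈x y)) y<ε)

  1^n≈1 : ∀ n → 1# ^ n ≈ 1#
  1^n≈1 zero    = refl
  1^n≈1 (suc n) = trans (*-identityˡ _) (1^n≈1 n)

  -- Topologically nilpotent elements have a power in V and so lie in the radical of `Span V`. As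
  -- they generate the unit ideal, a power of 1 lies in `Span V`.
  analytic⇒1∈span : IsAnalytic R → ∀ {V} → Open V → 0# ∈ V → 1# ∈ Span V
  analytic⇒1∈span 1∈span {V} V-open 0∈V =
    let (n , 1ⁿ∈) = span-least (radical-isIdeal (span-isIdeal V)) nilpotent⊆ 1∈span
    in resp (1^n≈1 n) 1ⁿ∈
    where
    nilpotent⊆ : TopologicallyNilpotent R ⊆ Radical (Span V)
    nilpotent⊆ nilpotent = let (n , tᵐ∈V) = nilpotent V-open 0∈V in n , gen (tᵐ∈V n ℕₚ.≤-refl)

  -- The norm is only submultiplicative, so a bound on x ^ n b for small b bounds x ^ n itself
  -- only because small elements generate the unit ideal.
  powerBounded⇒≤1 : IsAnalytic R → PowerMultiplicative ∥_∥ → ∀ {x} → PowerBounded R x → ∥ x ∥ ≤ᴿ 1ᴿ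
  powerBounded⇒≤1 analytic powerMult {x} bounded =
    let (V , V-open , 0∈V , xⁿV⊆ball) = bounded (ball-open 0<1) (lift (above-0 0<1))
        (c , xⁿ<c) = span-least T-isIdeal (λ b∈V → 1ℚ , λ n → lower (xⁿV⊆ball (n , refl) b∈V))
          (analytic⇒1∈span analytic V-open 0∈V)
    in ^ᴿ-bounded⇒≤1 ∥ x ∥ c λ n → proj₂ (powerMult x n) c (above-cong (*-identityʳ _) (xⁿ<c (suc n)))
    where
    -- The multipliers u that keep all products `x ^ n * u` bounded, uniformly in n. They form an
    -- ideal containing V, and hence 1.
    T : Pred Carrier _
    T u = ∃ λ c → ∀ n → Above ∥ x ^ n * u ∥ c

    T-isIdeal : IsIdeal T
    T-isIdeal = record
      { zero∈ = 1ℚ , λ n → above-cong (sym (zeroʳ _)) (above-0 0<1)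
      ; add∈  = λ {u} {v} (c , u<c) (d , v<d) → c ℚ.⊔ d , λ n → above-cong (sym (distribˡ _ _ _))
          (above-+ (ℝ∞.upward ∥ x ^ n * u ∥ (ℚₚ.p≤p⊔q c d) (u<c n))
                   (ℝ∞.upward ∥ x ^ n * v ∥ (ℚₚ.p≤q⊔p c d) (v<d n)))
      ; mul∈  = λ a {u} (c , u<c) → let (b , a<b) = N.finite a in b ℚ.* c , λ n →
          above-cong (solve 3 (λ a y u → a :* (y :* u) := y :* (a :* u)) refl a (x ^ n) u)
            (N.submultiplicative a (x ^ n * u) _ (b , c , a<b , u<c n , ℚₚ.≤-refl))
      ; resp∈ = λ u≈v (c , u<c) → c , λ n → above-cong (*-congˡ u≈v) (u<c n)
      }

  module _
    (R⁺ : Subring commutativeRing) {m : ℕ} (x : Vector (Ring.Carrier (Subring.asRing R⁺)) m)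
    (x-def : GeneratesIdealOfDefinition R R⁺ x) where

    private
      module S = Ring (Subring.asRing R⁺)
      module SI = Ideals (Subring.asRing R⁺)
      module SP = RingProperties S.ring

    -- An ideal is a union of its own cosets and therefore adically open, with exponent 1. It is
    -- thus the trace on R⁺ of an open set containing 0.
    ball⊆⟨x⟩ : ∃ λ δ → 0ℚ ℚ.< δ × (∀ y → Above ∥ proj₁ y ∥ δ → y ∈ S.⟨ x ⟩)
    ball⊆⟨x⟩ =
      let (V , V-open , ⟨x⟩⊆V , V⊆⟨x⟩) = Equivalence.from (x-def S.⟨ x ⟩) λ y y∈ → 1 , λ z z-y∈ →
            S.resp (SP.//-rightDividesˡ y z) (S.add (SI.^ᴵ1⊆ (SI.span-isIdeal _) z-y∈) y∈)
          (δ , 0<δ , ball⊆V) = open⇒⊇ball V-open (⟨x⟩⊆V S.zero)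
      in δ , 0<δ , λ y y<δ → V⊆⟨x⟩ (ball⊆V (proj₁ y) y<δ)

    ⟨x⟩^⊆ball : ∀ {δ} → 0ℚ ℚ.< δ → ∃ λ n → ∀ y → y ∈ S.⟨ x ⟩ S.^ᴵ n → Above ∥ proj₁ y ∥ δ
    ⟨x⟩^⊆ball {δ} 0<δ =
      let (n , ⟨x⟩ⁿ⊆) = Equivalence.to (x-def (Ball δ ∘ proj₁))
            (Ball δ , ball-open 0<δ , id , id) S.0# (lift (above-0 0<δ))
      in n , λ y y∈ → lower (⟨x⟩ⁿ⊆ y (SI.IsIdeal.resp∈ (SI.^ᴵ-isIdeal S.⟨ x ⟩ n) (sym (x-0≈x (proj₁ y))) y∈))

-- The rational that witnesses `ρ <ᴿ 1ᴿ` may equal 1; roundedness of the cut ρ supplies a strictly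
-- smaller one.
<1⇒above<1 : ∀ ρ → ρ <ᴿ 1ᴿ → ∃ λ q → q ℚ.< 1ℚ × Above ρ q
<1⇒above<1 ρ (q , ρ<q , q≤) =
  let (r , r<q , ρ<r) = ℝ∞.rounded ρ ρ<q in r , ℚₚ.<-≤-trans r<q q≤1 , ρ<r
  where
  q≤1 : q ℚ.≤ 1ℚ
  q≤1 with q ℚₚ.≤? 1ℚ
  ... | yes q≤1 = q≤1
  ... | no  q≰1 = let (r , 1<r , r<q) = ℚₚ.<-dense (ℚₚ.≰⇒> q≰1)
                  in contradiction (ℚₚ.<-≤-trans r<q (q≤ r 1<r)) (ℚₚ.<-irrefl ≡.refl)

-- The Gauss norm and the J-adic topology

module GaussNorm
  {p : ℕ} (pp : Prime p) (S : CommutativeRing ℓ ℓ) (𝕎 : WittVectors p S)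
  {m : ℕ} (x : Vector (Ring.Carrier S) m)
  (root : ∀ a → ∃ λ b → Ring._≈_ S (Ring._^_ S b p) a)
  (∥_∥ : Ring.Carrier S → ℝ∞)
  (∥∥-cong : ∀ {a b} → Ring._≈_ S a b → ∥ a ∥ ≤ᴿ ∥ b ∥)
  (∥∥-≤1 : ∀ a → ∥ a ∥ ≤ᴿ 1ᴿ)
  (∥∥-^ : ∀ a n → ∥ a ∥ ^ᴿ suc n ≤ᴿ ∥ Ring._^_ S a (suc n) ∥)
  (ρ : ℝ∞) (0<ρ : 0ᴿ <ᴿ ρ) (ρ<1 : ρ <ᴿ 1ᴿ) where

  open Teichmüller pp S 𝕎 x
  private
    module S = Ring S
    module 𝕎 = WittVectors 𝕎
    module W = Ring 𝕎.commutativeRing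
    module WI = Ideals 𝕎.commutativeRing
    q = proj₁ (<1⇒above<1 ρ ρ<1)
    q<1 = proj₁ (proj₂ (<1⇒above<1 ρ ρ<1))
    ρ<q = proj₂ (proj₂ (<1⇒above<1 ρ ρ<1))
    0<q = ℝ∞.positive ρ ρ<q
    c = proj₁ 0<ρ
    0<c = proj₁ (proj₂ 0<ρ)
    c≤ρ = proj₂ (proj₂ 0<ρ)

  ∥_∥ρ : W.Carrier → ℝ∞
  ∥_∥ρ = 𝕎.gaussNorm ∥_∥ ρ

  ρ^<2 : ∀ n → Above (ρ ^ᴿ n) 2ℚ
  ρ^<2 n = ℝ∞.upward (ρ ^ᴿ n)
    (ℚₚ.*-monoˡ-≤-nonNeg 2ℚ (^-≤1 0<q (ℚₚ.<⇒≤ q<1) n)) (^ᴿ-above ρ ρ<q n)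

  ∥∥-<2 : ∀ a → Above ∥ a ∥ 2ℚ
  ∥∥-<2 a = ∥∥-≤1 a 2ℚ 1<2

  gaussNorm-finite : ∀ y → Finite ∥ y ∥ρ
  -- Each term is below `2 * 2`; one is added because `sup` asks for a common bound strictly below
  -- the given rational.
  gaussNorm-finite y = 2ℚ ℚ.* 2ℚ ℚ.+ 1ℚ , 2ℚ ℚ.* 2ℚ , 4<5 , λ n →
    2ℚ , 2ℚ , ρ^<2 n , ∥∥-<2 (𝕎.digit y n) , ℚₚ.≤-refl
    where
    4<5 : 2ℚ ℚ.* 2ℚ ℚ.< 2ℚ ℚ.* 2ℚ ℚ.+ 1ℚ
    4<5 = ℚₚ.+-monoʳ-< (2ℚ ℚ.* 2ℚ) 0<1

  -- From index k on, the weight alone makes the terms small, since digits have norm at most 1. For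
  -- the digits up to k, `digit∈I^` provides a power of J on which their norms are small.
  J^⊆gaussBall : (∀ {δ} → 0ℚ ℚ.< δ → ∃ λ n → ∀ a → a ∈ I S.^ᴵ n → Above ∥ a ∥ δ) →
    ∀ {ε} → 0ℚ ℚ.< ε → ∃ λ N → ∀ z → z ∈ J W.^ᴵ N → Above ∥ z ∥ρ ε
  J^⊆gaussBall I^⊆ball {ε} 0<ε =
    let (r , 0<r , r<ε) = ℚₚ.<-dense 0<ε
        -- The powers of ρ are bounded by 2, so digits below `r / 2` give terms below r. For large
        -- indices the bounds `2 * q ^ j` and 2 multiply to at most r once `q ^ k ≤ r / 4`.
        δ               = ½ ℚ.* r
        0<δ             = *-pos (ℚₚ.positive⁻¹ ½) 0<r
        (k , qᵏ≤)       = ^-vanishes 0<q q<1 (*-pos (ℚₚ.positive⁻¹ ½) 0<δ)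
        (n , Iⁿ⊆)       = I^⊆ball 0<δ
        (N , digit∈)    = digit∈I^ root k n
    in N , λ z z∈ → r , r<ε , λ j → term<r r k qᵏ≤ z (λ j j≤k → Iⁿ⊆ _ (digit∈ z∈ j j≤k)) j
    where
    open +-*-Solver
    term<r : ∀ r k → q ^ℚ k ℚ.≤ ½ ℚ.* (½ ℚ.* r) → ∀ z →
      (∀ j → j ℕ.≤ k → Above ∥ 𝕎.digit z j ∥ (½ ℚ.* r)) →
      ∀ j → Above (ρ ^ᴿ j *ᴿ ∥ 𝕎.digit z j ∥) r
    term<r r k qᵏ≤ z small j with ℕₚ.≤-total j k
    ... | inj₁ j≤k = 2ℚ , ½ ℚ.* r , ρ^<2 j , small j j≤k ,
      ℚₚ.≤-reflexive (solve 1 (λ r → con 2ℚ :* (con ½ :* r) := r) ≡.refl r)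
    ... | inj₂ k≤j = 2ℚ ℚ.* q ^ℚ j , 2ℚ , ^ᴿ-above ρ ρ<q j , ∥∥-<2 _ , (begin
      2ℚ ℚ.* q ^ℚ j ℚ.* 2ℚ              ≤⟨ ℚₚ.*-monoʳ-≤-nonNeg 2ℚ (ℚₚ.*-monoˡ-≤-nonNeg 2ℚ
                                             (ℚₚ.≤-trans (^-antitone 0<q (ℚₚ.<⇒≤ q<1) k≤j) qᵏ≤)) ⟩
      2ℚ ℚ.* (½ ℚ.* (½ ℚ.* r)) ℚ.* 2ℚ   ≡⟨ solve 1 (λ r → con 2ℚ :* (con ½ :* (con ½ :* r)) :* con 2ℚ := r) ≡.refl r ⟩
      r                                 ∎)
      where open ℚₚ.≤-Reasoning

  gaussBall⊆J^ : ∀ {δ} → 0ℚ ℚ.< δ → (∀ a → Above ∥ a ∥ δ → a ∈ I) →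
    ∀ n → ∃ λ ε → 0ℚ ℚ.< ε × (∀ z → Above ∥ z ∥ρ ε → z ∈ J W.^ᴵ n)
  gaussBall⊆J^ {δ} 0<δ ball⊆I n =
    ε , *-pos (^-pos 0<δ (p ℕ.^ n)) (^-pos 0<c n) ,
    λ z (r , r<ε , digit<) → [digits]∈J^⇒∈J^ n z λ k k<n →
      [small]∈ (n<p^n pp n) (root^ root n (𝕎.digit z k)) (digit-small z (ℚₚ.<⇒≤ r<ε) k k<n (digit< k))
    where
    -- Here c is a positive lower bound of ρ. For `k < n` division by the weight costs at most
    -- `c ^ n`, which leaves the k-th digit below `δ ^ (p ^ n)` and its root of order `p ^ n` below
    -- δ.
    ε = δ ^ℚ (p ℕ.^ n) ℚ.* c ^ℚ n

    c≤1 : c ℚ.≤ 1ℚ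
    c≤1 = ℚₚ.≤-trans (c≤ρ q ρ<q) (ℚₚ.<⇒≤ q<1)

    digit-small : ∀ z {r} → r ℚ.≤ ε → ∀ k → k ℕ.< n → Above (ρ ^ᴿ k *ᴿ ∥ 𝕎.digit z k ∥) r →
                  Above ∥ 𝕎.digit z k ∥ (δ ^ℚ (p ℕ.^ n))
    digit-small z {r} r≤ε k k<n (a , b , ρᵏ<a , digit<b , ab≤r) = ℝ∞.upward ∥ 𝕎.digit z k ∥
      (ℚₚ.*-cancelˡ-≤-pos (c ^ℚ k) {{ℚ.positive (^-pos 0<c k)}} (begin
        c ^ℚ k ℚ.* b                    ≤⟨ ℚₚ.*-monoʳ-≤-nonNeg b {{ℚ.nonNegative (ℚₚ.<⇒≤ (ℝ∞.positive ∥ 𝕎.digit z k ∥ digit<b))}}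
                                             (^ᴿ-lowerBound ρ 0<c c≤ρ k a ρᵏ<a) ⟩
        a ℚ.* b                         ≤⟨ ℚₚ.≤-trans ab≤r r≤ε ⟩
        δ ^ℚ (p ℕ.^ n) ℚ.* c ^ℚ n       ≤⟨ ℚₚ.*-monoˡ-≤-nonNeg (δ ^ℚ (p ℕ.^ n))
                                             {{ℚ.nonNegative (ℚₚ.<⇒≤ (^-pos 0<δ (p ℕ.^ n)))}}
                                             (^-antitone 0<c c≤1 (ℕₚ.<⇒≤ k<n)) ⟩
        δ ^ℚ (p ℕ.^ n) ℚ.* c ^ℚ k       ≡⟨ ℚₚ.*-comm (δ ^ℚ (p ℕ.^ n)) (c ^ℚ k) ⟩
        c ^ℚ k ℚ.* δ ^ℚ (p ℕ.^ n)       ∎)) digit<b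
      where open ℚₚ.≤-Reasoning

    [small]∈ : ∀ {s a} → n ℕ.< s → (∃ λ b → b S.^ s S.≈ a) → Above ∥ a ∥ (δ ^ℚ s) → 𝕎.[ a ] ∈ J W.^ᴵ n
    [small]∈ {suc s-1} {a} n<s (b , bˢ≈a) a<δˢ = WI.IsIdeal.resp∈ (WI.^ᴵ-isIdeal J n) (𝕎.[]-cong bˢ≈a)
      ([^]∈J^ (ball⊆I b (^ᴿ-above-cancel ∥ b ∥ s-1 0<δ
        (∥∥-^ b s-1 (δ ^ℚ suc s-1) (∥∥-cong bˢ≈a (δ ^ℚ suc s-1) a<δˢ)))) (ℕₚ.<⇒≤ n<s))

  -- Both notions of openness refer to the difference of two points only, so comparing
  -- neighbourhoods of 0 suffices.
  gaussNorm-topology :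
    (∃ λ δ → 0ℚ ℚ.< δ × (∀ a → Above ∥ a ∥ δ → a ∈ I)) →
    (∀ {δ} → 0ℚ ℚ.< δ → ∃ λ n → ∀ a → a ∈ I S.^ᴵ n → Above ∥ a ∥ δ) →
    W.NormOpen ∥_∥ρ ≋ W.AdicOpen J
  gaussNorm-topology (δ , 0<δ , ball⊆I) I^⊆ball V = mk⇔ normOpen⇒adicOpen adicOpen⇒normOpen
    where
    normOpen⇒adicOpen : V ∈ W.NormOpen ∥_∥ρ → V ∈ W.AdicOpen J
    normOpen⇒adicOpen V-open y y∈V =
      let (ε , 0<ε , ball⊆V) = V-open y y∈V
          (N , J^⊆)          = J^⊆gaussBall I^⊆ball 0<ε
      in N , λ z z-y∈ → ball⊆V z (J^⊆ (z W.- y) z-y∈)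

    adicOpen⇒normOpen : V ∈ W.AdicOpen J → V ∈ W.NormOpen ∥_∥ρ
    adicOpen⇒normOpen V-open y y∈V =
      let (n , J^⊆V)        = V-open y y∈V
          (ε , 0<ε , ball⊆) = gaussBall⊆J^ 0<δ ball⊆I n
      in ε , 0<ε , λ z z-y<ε → J^⊆V z (ball⊆ (z W.- y) z-y<ε)

-- Application to an analytic perfectoid pair

corollary5p6 :
    ∀ {ℓ : Level} (p : ℕ) → Prime p →
    (R : TopologicalRing ℓ) (let open TopologicalRing R) →
    (R⁺ : Subring commutativeRing) →
    IsAnalyticPerfectoidPair R p R⁺ →
    HasCharacteristic p → Perfect p →
    (∥_∥ : Carrier → ℝ∞) → IsNorm ∥_∥ → PowerMultiplicative ∥_∥ →
    Open ≋ NormOpen ∥_∥ →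
    (m : ℕ) (x : Fin (suc m) → Ring.Carrier (Subring.asRing R⁺)) →
    GeneratesIdealOfDefinition R R⁺ x →
    (ρ : ℝ∞) → 0ᴿ <ᴿ ρ → ρ <ᴿ 1ᴿ →
    (𝕎 : WittVectors p (Subring.asRing R⁺)) →
    let module 𝕎 = WittVectors 𝕎
        module W = Ring 𝕎.commutativeRing
        ∥_∥ρ = 𝕎.gaussNorm (∥_∥ ∘ proj₁) ρ
    in (∀ y → Finite ∥ y ∥ρ) ×
       W.NormOpen ∥_∥ρ ≋ W.AdicOpen W.⟨ W.fromℕ p ∷ (𝕎.[_] ∘ x) ⟩
corollary5p6 p pp R R⁺ pair _ perfect ∥_∥ isNorm powerMult open⇔ m x x-def ρ 0<ρ ρ<1 𝕎 =
  gaussNorm-finite , gaussNorm-topology (ball⊆⟨x⟩ R⁺ x x-def) (⟨x⟩^⊆ball R⁺ x x-def)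
  where
  open IsAnalyticPerfectoidPair pair
  open IsHuberPair isHuberPair
  open SubringRoots R R⁺
  open NormedRing R ∥_∥ isNorm open⇔

  ∥∥-cong : ∀ {a b} → TopologicalRing._≈_ R a b → ∥ a ∥ ≤ᴿ ∥ b ∥
  ∥∥-cong a≈b _ = above-cong (TopologicalRing.sym R a≈b)

  ∥∥-≤1 : ∀ a → ∥ proj₁ a ∥ ≤ᴿ 1ᴿ
  ∥∥-≤1 (_ , a∈) = powerBounded⇒≤1 analytic powerMult (A⁺-powerBounded a∈)

  ∥∥-^ : ∀ a n → ∥ proj₁ a ∥ ^ᴿ suc n ≤ᴿ ∥ proj₁ (Ring._^_ (Subring.asRing R⁺) a (suc n)) ∥
  ∥∥-^ a n = ≡.subst (λ b → ∥ proj₁ a ∥ ^ᴿ suc n ≤ᴿ ∥ b ∥) (≡.sym (proj₁-^ a (suc n)))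
    (proj₂ (powerMult (proj₁ a) n))

  open GaussNorm pp (Subring.asRing R⁺) 𝕎 x (perfect⇒root pp A⁺-integrallyClosed perfect)
    (∥_∥ ∘ proj₁) ∥∥-cong ∥∥-≤1 ∥∥-^ ρ 0<ρ ρ<1
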